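{- Let $\omega_a:\Lambda(x\|a)\to\Lambda(x\|a')$ be the $\mathbb Q[a]$-linear ring homomorphism with $\omega_a:e_k(x\|a)\mapsto h_k(x\|a')$ for $k=1,2,\dots$. Then $\omega_{a'}\circ\omega_a=\mathrm{id}_{\Lambda(x\|a)}$, and for every partition $\lambda$ $$\omega_a:h_\lambda(x\|a)\mapsto e_\lambda(x\|a').$$
   Context: Let $a=(a_i)_{i\in\mathbb Z}$ be a sequence of commuting indeterminates and $\mathbb Q[a]$ the polynomial ring in the $a_i$. Let $a'$ be the sequence with $(a')_i=-a_{ -i+1}$, $i\in\mathbb Z$; then $(a')'=a$, and $\mathbb Q[a']$ is identified with $\mathbb Q[a]$ by replacing each $(a')_i$ with $-a_{ -i+1}$. The ring $\Lambda(x\|a)$: its elements are sequences $P=(P_0,P_1,P_2,\dots)$, where $P_n$ is a symmetric polynomial in $x_1,\dots,x_n$ with coefficients in $\mathbb Q[a]$, the total degrees of the $P_n$ in the $x_i$ are bounded, and $P_n(x_1,\dots,x_{n-1},a_n)=P_{n-1}(x_1,\dots,x_{n-1})$ for all $n\geqslant 1$; multiplication is componentwise. $\Lambda(x\|a')$ is the same construction with $a'$ in place of $a$. The double elementary and complete symmetric functions are the elements of $\Lambda(x\|a)$ $$e_k(x\|a)=\sum_{i_1>\dots>i_k}(x_{i_1}-a_{i_1})(x_{i_2}-a_{i_2+1})\cdots(x_{i_k}-a_{i_k+k-1}),\qquad h_k(x\|a)=\sum_{i_1\geqslant\dots\geqslant i_k}(x_{i_1}-a_{i_1})(x_{i_2}-a_{i_2-1})\cdots(x_{i_k}-a_{i_k-k+1})$$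 (indices in $\{1,\dots,n\}$ for the $n$-th component). For $\lambda=(\lambda_1,\dots,\lambda_l)$ put $e_\lambda(x\|a)=e_{\lambda_1}(x\|a)\cdots e_{\lambda_l}(x\|a)$ and $h_\lambda(x\|a)=h_{\lambda_1}(x\|a)\cdots h_{\lambda_l}(x\|a)$. Each of the families $(e_k(x\|a))_{k\geqslant 1}$, $(h_k(x\|a))_{k\geqslant 1}$ is a set of algebraically independent generators of $\Lambda(x\|a)$ over $\mathbb Q[a]$, so $\omega_a$ is well defined: $\omega_a\big(\sum_\lambda c_\lambda(a)e_\lambda(x\|a)\big)=\sum_\lambda c_\lambda(a)h_\lambda(x\|a')$, with $c_\lambda(a)\in\mathbb Q[a]$ regarded as an element of $\mathbb Q[a']$. The map $\omega_{a'}$ is defined in the same way with $a$ and $a'$ interchanged. -}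

module Defs where

open import Algebra.Bundles using (CommutativeRing)
open import Algebra.Module.Core using (Opₗ)
open import Algebra.Module.Morphism.Definitions using (Homomorphicₗ)
open import Algebra.Morphism.Structures using (module RingMorphisms)
open import Data.Bool.Base using (Bool; T; true; false; if_then_else_; _∧_)
open import Data.Fin.Base using (Fin; zero; suc; toℕ; fromℕ; fromℕ<; inject₁)
open import Data.Fin.Permutation using (Permutation′; _⟨$⟩ʳ_)
open import Data.Fin.Properties using (toℕ-fromℕ<; fromℕ<-toℕ; toℕ<n; toℕ-fromℕ; toℕ-inject₁)
  renaming (_<?_ to _<F?_; _≤?_ to _≤F?_)
open import Data.Integer.Base as ℤ using (ℤ; +_; 1ℤ; -1ℤ)
import Data.Integer.Properties as ℤₚ
open import Data.List.Base
  using (List; []; _∷_; _++_; map; foldr; filter; length; allFin; tabulate; cartesianProductWith;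
         applyDownFrom; applyUpTo)
open import Data.List.Properties using (length-++; length-applyDownFrom; reverse-applyUpTo)
open import Data.List.Relation.Binary.Permutation.Propositional as ↭ using (_↭_; ↭-sym; ↭-trans; ↭-reflexive)
open import Data.List.Relation.Binary.Permutation.Propositional.Properties
  using (↭-length; ↭-reverse; ++-commutativeMonoid)
open import Data.List.Relation.Unary.All as All using (All; []; _∷_)
open import Data.List.Relation.Unary.All.Properties using (++⁺; map⁺)
open import Data.List.Relation.Unary.Linked using (Linked)
open import Data.Nat.Base as ℕ using (ℕ; zero; suc; _≤_; _<_; _≥_; _⊔_; _<ᵇ_; z≤n; s≤s)
open import Data.Nat.Properties as ℕₚ using (_<?_)
open import Data.Product.Base using (_×_; _,_; ∃; proj₁; proj₂)
open import Data.Rational.Properties using () renaming (+-*-commutativeRing to ℚ-commutativeRing)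
open import Data.Vec.Base using (Vec; []; _∷_; lookup)
open import Data.Vec.Functional as F using (insertAt)
open import Data.Vec.Relation.Unary.Linked using (linked?)
open import Function.Base using (_∘_; id)
open import Level using (0ℓ)
open import Relation.Binary.Core using (Rel)
open import Relation.Binary.Definitions using () renaming (Decidable to Decidable₂)
open import Relation.Binary.PropositionalEquality as ≡ using (_≡_)
open import Relation.Nullary.Decidable using (does; yes; no)
open import Relation.Nullary.Negation using (contradiction)
open import Relation.Unary using (Decidable)

tuples : (k n : ℕ) → List (Vec (Fin n) k)
tuples zero    n = [] ∷ []
tuples (suc k) n = cartesianProductWith _∷_ (allFin n) (tuples k n)

module BigOps (A : CommutativeRing 0ℓ 0ℓ) where
  open CommutativeRing A

  ∑ : {X : Set} → List X → (X → Carrier) → Carrier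
  ∑ xs f = foldr (λ x s → f x + s) 0# xs

  infixr 6 ∑
  syntax ∑ xs (λ x → t) = ∑[ x ∈ xs ] t

  ∏ : (n : ℕ) → (Fin n → Carrier) → Carrier
  ∏ n f = F.foldr _*_ 1# {n} f

  infixr 7 ∏
  syntax ∏ n (λ i → t) = ∏[ i < n ] t

-- The polynomial ring R[V] in commuting indeterminates V: the free
-- commutative R-algebra on V, i.e. formal expressions modulo the
-- congruence generated by the axioms of commutative R-algebras.

module Polynomials (R : CommutativeRing 0ℓ 0ℓ) where
  private module R = CommutativeRing R

  infixl 6 _⊕_
  infixl 7 _⊗_
  infix  8 ⊖_
  infix  4 _≋_

  data Poly (V : Set) : Set where
    con     : R.Carrier → Poly V
    var     : V → Poly V
    _⊕_ _⊗_ : Poly V → Poly V → Poly V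
    ⊖_      : Poly V → Poly V

  data _≋_ {V : Set} : Rel (Poly V) 0ℓ where
    ≋-refl     : ∀ {p} → p ≋ p
    ≋-sym      : ∀ {p q} → p ≋ q → q ≋ p
    ≋-trans    : ∀ {p q r} → p ≋ q → q ≋ r → p ≋ r
    ⊕-cong     : ∀ {p p′ q q′} → p ≋ p′ → q ≋ q′ → p ⊕ q ≋ p′ ⊕ q′
    ⊗-cong     : ∀ {p p′ q q′} → p ≋ p′ → q ≋ q′ → p ⊗ q ≋ p′ ⊗ q′
    ⊖-cong     : ∀ {p p′} → p ≋ p′ → ⊖ p ≋ ⊖ p′
    ⊕-assoc    : ∀ p q r → (p ⊕ q) ⊕ r ≋ p ⊕ (q ⊕ r)
    ⊕-comm     : ∀ p q → p ⊕ q ≋ q ⊕ p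
    ⊕-identity : ∀ p → con R.0# ⊕ p ≋ p
    ⊕-inverse  : ∀ p → ⊖ p ⊕ p ≋ con R.0#
    ⊗-assoc    : ∀ p q r → (p ⊗ q) ⊗ r ≋ p ⊗ (q ⊗ r)
    ⊗-comm     : ∀ p q → p ⊗ q ≋ q ⊗ p
    ⊗-identity : ∀ p → con R.1# ⊗ p ≋ p
    ⊗-distrib  : ∀ p q r → p ⊗ (q ⊕ r) ≋ p ⊗ q ⊕ p ⊗ r
    con-cong   : ∀ {c d} → c R.≈ d → con c ≋ con d
    con-+      : ∀ c d → con (c R.+ d) ≋ con c ⊕ con d
    con-*      : ∀ c d → con (c R.* d) ≋ con c ⊗ con d

  polynomialRing : Set → CommutativeRing 0ℓ 0ℓ
  polynomialRing V = record
    { Carrier = Poly V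
    ; _≈_     = _≋_
    ; _+_     = _⊕_
    ; _*_     = _⊗_
    ; -_      = ⊖_
    ; 0#      = con R.0#
    ; 1#      = con R.1#
    ; isCommutativeRing = record
      { isRing = record
        { +-isAbelianGroup = record
          { isGroup = record
            { isMonoid = record
              { isSemigroup = record
                { isMagma = record
                  { isEquivalence = record { refl = ≋-refl ; sym = ≋-sym ; trans = ≋-trans }
                  ; ∙-cong        = ⊕-cong
                  }
                ; assoc   = ⊕-assoc
                }
              ; identity = ⊕-identity , λ p → ≋-trans (⊕-comm _ _) (⊕-identity p)
              }
            ; inverse = ⊕-inverse , λ p → ≋-trans (⊕-comm _ _) (⊕-inverse p)
            ; ⁻¹-cong = ⊖-cong
            }
          ; comm = ⊕-comm
          }
        ; *-cong     = ⊗-cong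
        ; *-assoc    = ⊗-assoc
        ; *-identity = ⊗-identity , λ p → ≋-trans (⊗-comm _ _) (⊗-identity p)
        ; distrib    = ⊗-distrib , λ p q r → ≋-trans (⊗-comm _ _)
                         (≋-trans (⊗-distrib p q r) (⊕-cong (⊗-comm _ _) (⊗-comm _ _)))
        }
      ; *-comm = ⊗-comm
      }
    }

  substitute : {V W : Set} → (V → Poly W) → Poly V → Poly W
  substitute f (con c) = con c
  substitute f (var v) = f v
  substitute f (p ⊕ q) = substitute f p ⊕ substitute f q
  substitute f (p ⊗ q) = substitute f p ⊗ substitute f q
  substitute f (⊖ p)   = ⊖ substitute f p

  substitute-cong : {V W : Set} (f : V → Poly W) {p q : Poly V} → p ≋ q → substitute f p ≋ substitute f q
  substitute-cong f ≋-refl             = ≋-refl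
  substitute-cong f (≋-sym e)          = ≋-sym (substitute-cong f e)
  substitute-cong f (≋-trans d e)      = ≋-trans (substitute-cong f d) (substitute-cong f e)
  substitute-cong f (⊕-cong d e)       = ⊕-cong (substitute-cong f d) (substitute-cong f e)
  substitute-cong f (⊗-cong d e)       = ⊗-cong (substitute-cong f d) (substitute-cong f e)
  substitute-cong f (⊖-cong e)         = ⊖-cong (substitute-cong f e)
  substitute-cong f (⊕-assoc p q r)    = ⊕-assoc _ _ _
  substitute-cong f (⊕-comm p q)       = ⊕-comm _ _
  substitute-cong f (⊕-identity p)     = ⊕-identity _
  substitute-cong f (⊕-inverse p)      = ⊕-inverse _
  substitute-cong f (⊗-assoc p q r)    = ⊗-assoc _ _ _
  substitute-cong f (⊗-comm p q)       = ⊗-comm _ _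
  substitute-cong f (⊗-identity p)     = ⊗-identity _
  substitute-cong f (⊗-distrib p q r)  = ⊗-distrib _ _ _
  substitute-cong f (con-cong e)       = con-cong e
  substitute-cong f (con-+ c d)        = con-+ c d
  substitute-cong f (con-* c d)        = con-* c d

  -- A linear combination of monomials, each monomial being given by the
  -- list of its indeterminates with repetitions.
  combination : {V : Set} → List (R.Carrier × List V) → Poly V
  combination {V} ts = ∑[ t ∈ ts ] con (proj₁ t) ⊗ foldr (λ v m → var v ⊗ m) (con R.1#) (proj₂ t)
    where open BigOps (polynomialRing V)

  TotalDegree≤ : {V : Set} → ℕ → Poly V → Set
  TotalDegree≤ d p = ∃ λ ts → All (λ t → length (proj₂ t) ≤ d) ts × p ≋ combination ts

  Symmetric : {n : ℕ} → Poly (Fin n) → Set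
  Symmetric {n} p = (σ : Permutation′ n) → substitute (λ i → var (σ ⟨$⟩ʳ i)) p ≋ p

  module Degree {V : Set} where
    private
      module P = CommutativeRing (polynomialRing V)
    open import Relation.Binary.Reasoning.Setoid P.setoid
    open import Algebra.Properties.Ring P.ring using (-‿distribˡ-*; -‿+-comm; -0#≈0#)
    open import Algebra.Properties.CommutativeSemigroup P.*-commutativeSemigroup using (interchange)
    open BigOps (polynomialRing V)

    private
      Term : Set
      Term = R.Carrier × List V

      mono : List V → Poly V
      mono = foldr (λ v m → var v ⊗ m) (con R.1#)

      term : Term → Poly V
      term (c , m) = con c ⊗ mono m

      con-neg : ∀ c → con (R.- c) ≋ ⊖ con c
      con-neg c = begin
        con (R.- c)                          ≈⟨ P.+-identityʳ _ ⟨
        con (R.- c) ⊕ con R.0#               ≈⟨ P.+-congˡ (P.-‿inverseʳ (con c)) ⟨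
        con (R.- c) ⊕ (con c ⊕ ⊖ con c)      ≈⟨ P.+-assoc _ _ _ ⟨
        (con (R.- c) ⊕ con c) ⊕ ⊖ con c      ≈⟨ P.+-congʳ (con-+ _ _) ⟨
        con (R.- c R.+ c) ⊕ ⊖ con c          ≈⟨ P.+-congʳ (con-cong (R.-‿inverseˡ c)) ⟩
        con R.0# ⊕ ⊖ con c                   ≈⟨ P.+-identityˡ _ ⟩
        ⊖ con c                              ∎

      comb-++ : ∀ ss ts → combination (ss ++ ts) ≋ combination ss ⊕ combination ts
      comb-++ []       ts = ≋-sym (P.+-identityˡ _)
      comb-++ (s ∷ ss) ts = begin
        term s ⊕ combination (ss ++ ts)              ≈⟨ P.+-congˡ (comb-++ ss ts) ⟩
        term s ⊕ (combination ss ⊕ combination ts)   ≈⟨ P.+-assoc _ _ _ ⟨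
        term s ⊕ combination ss ⊕ combination ts     ∎

      mono-++ : ∀ l m → mono (l ++ m) ≋ mono l ⊗ mono m
      mono-++ []      m = ≋-sym (P.*-identityˡ _)
      mono-++ (v ∷ l) m = begin
        var v ⊗ mono (l ++ m)        ≈⟨ P.*-congˡ (mono-++ l m) ⟩
        var v ⊗ (mono l ⊗ mono m)    ≈⟨ P.*-assoc _ _ _ ⟨
        var v ⊗ mono l ⊗ mono m      ∎

      negT : Term → Term
      negT (c , m) = R.- c , m

      comb-neg : ∀ ts → combination (map negT ts) ≋ ⊖ combination ts
      comb-neg []             = ≋-sym -0#≈0#
      comb-neg ((c , m) ∷ ts) = begin
        con (R.- c) ⊗ mono m ⊕ combination (map negT ts)  ≈⟨ P.+-cong (P.*-congʳ (con-neg c)) (comb-neg ts) ⟩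
        ⊖ con c ⊗ mono m ⊕ ⊖ combination ts               ≈⟨ P.+-congʳ (-‿distribˡ-* _ _) ⟨
        ⊖ (con c ⊗ mono m) ⊕ ⊖ combination ts             ≈⟨ -‿+-comm _ _ ⟩
        ⊖ (con c ⊗ mono m ⊕ combination ts)               ∎

      mulT : Term → Term → Term
      mulT (c , l) (d , m) = c R.* d , l ++ m

      comb-scale : ∀ s ts → combination (map (mulT s) ts) ≋ term s ⊗ combination ts
      comb-scale s             []             = ≋-sym (P.zeroʳ _)
      comb-scale s@(c , l) ((d , m) ∷ ts) = begin
        con (c R.* d) ⊗ mono (l ++ m) ⊕ combination (map (mulT s) ts)
          ≈⟨ P.+-cong (P.*-cong (con-* c d) (mono-++ l m)) (comb-scale s ts) ⟩
        con c ⊗ con d ⊗ (mono l ⊗ mono m) ⊕ term s ⊗ combination ts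
          ≈⟨ P.+-congʳ (interchange _ _ _ _) ⟩
        term s ⊗ term (d , m) ⊕ term s ⊗ combination ts
          ≈⟨ ⊗-distrib _ _ _ ⟨
        term s ⊗ (term (d , m) ⊕ combination ts) ∎

      mul : List Term → List Term → List Term
      mul []       ts = []
      mul (s ∷ ss) ts = map (mulT s) ts ++ mul ss ts

      comb-mul : ∀ ss ts → combination (mul ss ts) ≋ combination ss ⊗ combination ts
      comb-mul []       ts = ≋-sym (P.zeroˡ _)
      comb-mul (s ∷ ss) ts = begin
        combination (map (mulT s) ts ++ mul ss ts)               ≈⟨ comb-++ (map (mulT s) ts) _ ⟩
        combination (map (mulT s) ts) ⊕ combination (mul ss ts)  ≈⟨ P.+-cong (comb-scale s ts) (comb-mul ss ts) ⟩
        term s ⊗ combination ts ⊕ combination ss ⊗ combination ts ≈⟨ P.distribʳ _ _ _ ⟨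
        (term s ⊕ combination ss) ⊗ combination ts ∎

      mul-bound : ∀ {d e} (ss ts : List Term) → All (λ t → length (proj₂ t) ≤ d) ss → All (λ t → length (proj₂ t) ≤ e) ts →
                  All (λ t → length (proj₂ t) ≤ d ℕ.+ e) (mul ss ts)
      mul-bound []       ts []       qs = []
      mul-bound {d} {e} (s ∷ ss) ts (p ∷ ps) qs = ++⁺ (map⁺ (All.map (λ {t} → bound t) qs)) (mul-bound ss ts ps qs)
        where
        bound : ∀ t → length (proj₂ t) ≤ e → length (proj₂ (mulT s t)) ≤ d ℕ.+ e
        bound t q = ≡.subst (_≤ d ℕ.+ e) (≡.sym (length-++ (proj₂ s))) (ℕₚ.+-mono-≤ p q)

    deg-resp : ∀ {d} {p q : Poly V} → p ≋ q → TotalDegree≤ d p → TotalDegree≤ d q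
    deg-resp e (ts , b , f) = ts , b , ≋-trans (≋-sym e) f

    deg-mono : ∀ {d e} {p : Poly V} → d ≤ e → TotalDegree≤ d p → TotalDegree≤ e p
    deg-mono d≤e (ts , b , f) = ts , All.map (λ l → ℕₚ.≤-trans l d≤e) b , f

    deg-con : ∀ {d} c → TotalDegree≤ {V} d (con c)
    deg-con c = (c , []) ∷ [] , z≤n ∷ [] , ≋-sym (≋-trans (P.+-identityʳ _) (P.*-identityʳ _))

    deg-var : ∀ v → TotalDegree≤ 1 (var v)
    deg-var v = (R.1# , v ∷ []) ∷ [] , s≤s z≤n ∷ [] ,
      ≋-sym (≋-trans (P.+-identityʳ _) (≋-trans (P.*-identityˡ _) (P.*-identityʳ _)))

    deg-⊕ : ∀ {d} {p q : Poly V} → TotalDegree≤ d p → TotalDegree≤ d q → TotalDegree≤ d (p ⊕ q)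
    deg-⊕ (ss , a , e) (ts , b , f) = ss ++ ts , ++⁺ a b , ≋-trans (⊕-cong e f) (≋-sym (comb-++ ss ts))

    deg-⊖ : ∀ {d} {p : Poly V} → TotalDegree≤ d p → TotalDegree≤ d (⊖ p)
    deg-⊖ (ts , b , f) = map negT ts , map⁺ b , ≋-trans (⊖-cong f) (≋-sym (comb-neg ts))

    deg-⊗ : ∀ {d e} {p q : Poly V} → TotalDegree≤ d p → TotalDegree≤ e q → TotalDegree≤ (d ℕ.+ e) (p ⊗ q)
    deg-⊗ (ss , a , e) (ts , b , f) = mul ss ts , mul-bound ss ts a b , ≋-trans (⊗-cong e f) (≋-sym (comb-mul ss ts))

    deg-∑ : ∀ {d} {X : Set} (xs : List X) {f : X → Poly V} →
            (∀ x → TotalDegree≤ d (f x)) → TotalDegree≤ d (∑ xs f)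
    deg-∑ []       h = deg-con _
    deg-∑ (x ∷ xs) h = deg-⊕ (h x) (deg-∑ xs h)

    deg-∏ : ∀ k {f : Fin k → Poly V} → (∀ i → TotalDegree≤ 1 (f i)) → TotalDegree≤ k (∏ k f)
    deg-∏ zero    h = deg-con _
    deg-∏ (suc k) h = deg-⊗ (h zero) (deg-∏ k (h ∘ suc))

-- The sums e_k(x‖b) and h_k(x‖b) in n variables.  The variable x_i is
-- x at the element i - 1 of Fin n, and position j of an index tuple I
-- holds i_{j+1} - 1.
module DoubleSums (A : CommutativeRing 0ℓ 0ℓ) where
  open CommutativeRing A hiding (zero)
  open BigOps A

  eSum hSum : {n : ℕ} → ℕ → (Fin n → Carrier) → (ℤ → Carrier) → Carrier
  eSum {n} k x b =
    ∑[ I ∈ filter (linked? (λ i i′ → i′ <F? i)) (tuples k n) ]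
      ∏[ j < k ] (x (lookup I j) - b (+ suc (toℕ (lookup I j)) ℤ.+ + toℕ j))
  hSum {n} k x b =
    ∑[ I ∈ filter (linked? (λ i i′ → i′ ≤F? i)) (tuples k n) ]
      ∏[ j < k ] (x (lookup I j) - b (+ suc (toℕ (lookup I j)) ℤ.- + toℕ j))

  open import Relation.Binary.Reasoning.Setoid setoid
  open import Algebra.Solver.Ring.NaturalCoefficients.Default commutativeSemiring
    using (solve; _:=_; _:+_; _:*_)
  open import Algebra.Properties.Ring ring using (+-cancelʳ)

  ∑-cong : {X : Set} (xs : List X) {f g : X → Carrier} → (∀ x → f x ≈ g x) → ∑ xs f ≈ ∑ xs g
  ∑-cong []       h = refl
  ∑-cong (x ∷ xs) h = +-cong (h x) (∑-cong xs h)

  ∑-zero : {X : Set} (xs : List X) → ∑ xs (λ _ → 0#) ≈ 0#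
  ∑-zero []       = refl
  ∑-zero (x ∷ xs) = trans (+-identityˡ _) (∑-zero xs)

  ∑-++ : {X : Set} (xs ys : List X) (f : X → Carrier) → ∑ (xs ++ ys) f ≈ ∑ xs f + ∑ ys f
  ∑-++ []       ys f = sym (+-identityˡ _)
  ∑-++ (x ∷ xs) ys f = trans (+-congˡ (∑-++ xs ys f)) (sym (+-assoc _ _ _))

  ∑-map : {X Y : Set} (g : X → Y) (xs : List X) (f : Y → Carrier) → ∑ (map g xs) f ≈ ∑ xs (f ∘ g)
  ∑-map g []       f = refl
  ∑-map g (x ∷ xs) f = +-congˡ (∑-map g xs f)

  ∑-scale : {X : Set} (c : Carrier) (xs : List X) (f : X → Carrier) → ∑ xs (λ x → c * f x) ≈ c * ∑ xs f
  ∑-scale c []       f = sym (zeroʳ c)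
  ∑-scale c (x ∷ xs) f = trans (+-congˡ (∑-scale c xs f)) (sym (distribˡ _ _ _))

  ∑-product : {X Y Z : Set} (g : X → Y → Z) (xs : List X) (ys : List Y) (f : Z → Carrier) →
              ∑ (cartesianProductWith g xs ys) f ≈ ∑[ x ∈ xs ] ∑[ y ∈ ys ] f (g x y)
  ∑-product g []       ys f = refl
  ∑-product g (x ∷ xs) ys f = trans (∑-++ (map (g x) ys) _ f) (+-cong (∑-map (g x) ys f) (∑-product g xs ys f))

  ite : Bool → Carrier → Carrier
  ite t x = if t then x else 0#

  ite-cong : ∀ t {x y} → x ≈ y → ite t x ≈ ite t y
  ite-cong true  e = e
  ite-cong false e = refl

  ite-true : ∀ t {x} → T t → x ≈ ite t x
  ite-true true _ = refl

  ite-∧ : ∀ s t x → ite (s ∧ t) x ≈ ite s (ite t x)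
  ite-∧ true  t x = refl
  ite-∧ false t x = refl

  ite-* : ∀ t c x → ite t (c * x) ≈ c * ite t x
  ite-* true  c x = refl
  ite-* false c x = sym (zeroʳ c)

  ∑-ite : {X : Set} (t : Bool) (xs : List X) (f : X → Carrier) → ∑ xs (λ x → ite t (f x)) ≈ ite t (∑ xs f)
  ∑-ite true  xs f = refl
  ∑-ite false xs f = ∑-zero xs

  ∑-filter : {X : Set} {P : X → Set} (P? : Decidable P) (xs : List X) (f : X → Carrier) →
             ∑ (filter P? xs) f ≈ ∑[ x ∈ xs ] ite (does (P? x)) (f x)
  ∑-filter P? []       f = refl
  ∑-filter P? (x ∷ xs) f with does (P? x)
  ... | true  = +-congˡ (∑-filter P? xs f)
  ... | false = trans (∑-filter P? xs f) (sym (+-identityˡ _))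

  ∑-tabulate : {X : Set} {n : ℕ} (g : Fin n → X) (f : X → Carrier) → ∑ (tabulate g) f ≈ ∑ (allFin n) (f ∘ g)
  ∑-tabulate {n = zero}  g f = refl
  ∑-tabulate {n = suc n} g f = +-congˡ (trans (∑-tabulate (g ∘ suc) f) (sym (∑-tabulate suc (f ∘ g))))

  -- Σ_{l < m} f l
  ∑< : ℕ → (ℕ → Carrier) → Carrier
  ∑< zero    f = 0#
  ∑< (suc m) f = ∑< m f + f m

  ∑<-head : ∀ m f → ∑< (suc m) f ≈ f 0 + ∑< m (f ∘ suc)
  ∑<-head zero    f = trans (+-identityˡ _) (sym (+-identityʳ _))
  ∑<-head (suc m) f = trans (+-congʳ (∑<-head m f)) (+-assoc _ _ _)

  ∑-below : ∀ n m → m ≤ n → (f : ℕ → Carrier) →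
            ∑[ i ∈ allFin n ] ite (toℕ i <ᵇ m) (f (toℕ i)) ≈ ∑< m f
  ∑-below n zero le f = ∑-zero (allFin n)
  ∑-below (suc n) (suc m) (s≤s le) f =
    trans (+-congˡ {f 0} shifted) (trans (+-congˡ (∑-below n m le (f ∘ suc))) (sym (∑<-head m f)))
    where
    shifted : ∑ (tabulate {n = n} suc) (λ i → ite (toℕ i <ᵇ suc m) (f (toℕ i))) ≈
              ∑[ i ∈ allFin n ] ite (toℕ i <ᵇ m) (f (suc (toℕ i)))
    shifted = ∑-tabulate {n = n} suc (λ i → ite (toℕ i <ᵇ suc m) (f (toℕ i)))

  -- x extended to all natural indices by 0
  ext : {n : ℕ} → (Fin n → Carrier) → ℕ → Carrier
  ext {n} x m with m <? n
  ... | yes m<n = x (fromℕ< m<n)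
  ... | no  _   = 0#

  ext-toℕ : ∀ {n} (x : Fin n → Carrier) i → ext x (toℕ i) ≡ x i
  ext-toℕ {n} x i with toℕ i <? n
  ... | yes i<n = ≡.cong x (fromℕ<-toℕ i i<n)
  ... | no  i≮n = contradiction (toℕ<n i) i≮n

  -- Both sums at once: the index following i + 1 ranges over 1, …, w i, and
  -- sh i j is the subscript of b in factor j at index i.
  module Recursion
    (w : ℕ → ℕ) (t : ℤ → ℤ) (sh : ℤ → ℕ → ℤ)
    (sh-zero : ∀ i → sh i 0 ≡ i) (sh-suc : ∀ i j → sh i (suc j) ≡ t (sh i j))
    where

    -- The sum of all terms of length k whose first index is at most m.
    S : ℕ → ℕ → (ℕ → Carrier) → (ℤ → Carrier) → Carrier
    S zero    m       y b = 1#
    S (suc k) zero    y b = 0#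
    S (suc k) (suc m) y b = S (suc k) m y b + (y m - b (+ suc m)) * S k (w m) y (b ∘ t)

    S-sum : ∀ k m y b → S (suc k) m y b ≈ ∑< m (λ l → (y l - b (+ suc l)) * S k (w l) y (b ∘ t))
    S-sum k zero    y b = refl
    S-sum k (suc m) y b = +-congʳ (S-sum k m y b)

    S-cong : ∀ {n} → (∀ {m} → m < n → w m ≤ n) → ∀ k m {y z} b → m ≤ n →
             (∀ {l} → l < n → y l ≈ z l) → S k m y b ≈ S k m z b
    S-cong w≤ zero    m       b le e = refl
    S-cong w≤ (suc k) zero    b le e = refl
    S-cong w≤ (suc k) (suc m) b le e =
      +-cong (S-cong w≤ (suc k) m b (ℕₚ.<⇒≤ le) e)
             (*-cong (+-congʳ (e le)) (S-cong w≤ k (w m) (b ∘ t) (w≤ le) e))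

    term : ∀ {n k} → (Fin n → Carrier) → (ℤ → Carrier) → Vec (Fin n) k → Carrier
    term {k = k} x b I = ∏[ j < k ] (x (lookup I j) - b (sh (+ suc (toℕ (lookup I j))) (toℕ j)))

    ∏-cong : ∀ k {f g : Fin k → Carrier} → (∀ i → f i ≈ g i) → ∏ k f ≈ ∏ k g
    ∏-cong zero    h = refl
    ∏-cong (suc k) h = *-cong (h zero) (∏-cong k (h ∘ suc))

    term-∷ : ∀ {n k} (x : Fin n → Carrier) b i (I : Vec (Fin n) k) →
             term x b (i ∷ I) ≈ (x i - b (+ suc (toℕ i))) * term x (b ∘ t) I
    term-∷ {k = k} x b i I = *-cong
      (reflexive (≡.cong (λ s → x i - b s) (sh-zero _)))
      (∏-cong k (λ j → reflexive (≡.cong (λ s → x (lookup I j) - b s) (sh-suc _ _))))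

    module _
      {n : ℕ} (w≤ : ∀ {m} → m < n → w m ≤ n)
      {_≻_ : Rel (Fin n) 0ℓ} (_≻?_ : Decidable₂ _≻_)
      (≻-does : ∀ i j → does (i ≻? j) ≡ (toℕ j <ᵇ w (toℕ i)))
      (x : Fin n → Carrier)
      where

      private
        linked : ∀ {k} → Vec (Fin n) k → Bool
        linked I = does (linked? _≻?_ I)

      tails : ∀ k i b → ∑[ I ∈ tuples k n ] ite (linked (i ∷ I)) (term x b I) ≈ S k (w (toℕ i)) (ext x) b
      first : ∀ k i b → ∑[ I ∈ tuples k n ] ite (linked (i ∷ I)) (term x b (i ∷ I))
                        ≈ (ext x (toℕ i) - b (+ suc (toℕ i))) * S k (w (toℕ i)) (ext x) (b ∘ t)
      first k i b = begin
        ∑[ I ∈ tuples k n ] ite (linked (i ∷ I)) (term x b (i ∷ I))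
          ≈⟨ ∑-cong (tuples k n) (λ I → ite-cong (linked (i ∷ I)) (term-∷ x b i I)) ⟩
        ∑[ I ∈ tuples k n ] ite (linked (i ∷ I)) (c * term x (b ∘ t) I)
          ≈⟨ ∑-cong (tuples k n) (λ I → ite-* (linked (i ∷ I)) c _) ⟩
        ∑[ I ∈ tuples k n ] c * ite (linked (i ∷ I)) (term x (b ∘ t) I)
          ≈⟨ ∑-scale c (tuples k n) _ ⟩
        c * (∑[ I ∈ tuples k n ] ite (linked (i ∷ I)) (term x (b ∘ t) I))
          ≈⟨ *-cong (+-congʳ (reflexive (≡.sym (ext-toℕ x i)))) (tails k i (b ∘ t)) ⟩
        (ext x (toℕ i) - b (+ suc (toℕ i))) * S k (w (toℕ i)) (ext x) (b ∘ t) ∎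
        where c = x i - b (+ suc (toℕ i))
      tails zero    i b = +-identityʳ 1#
      tails (suc k) i b = begin
        ∑[ I ∈ tuples (suc k) n ] ite (linked (i ∷ I)) (term x b I)
          ≈⟨ ∑-product _∷_ (allFin n) (tuples k n) _ ⟩
        ∑[ j ∈ allFin n ] ∑[ I ∈ tuples k n ] ite (linked (i ∷ j ∷ I)) (term x b (j ∷ I))
          ≈⟨ ∑-cong (allFin n) (λ j → ∑-cong (tuples k n) (λ I → ite-∧ (does (i ≻? j)) (linked (j ∷ I)) _)) ⟩
        ∑[ j ∈ allFin n ] ∑[ I ∈ tuples k n ] ite (does (i ≻? j)) (ite (linked (j ∷ I)) (term x b (j ∷ I)))
          ≈⟨ ∑-cong (allFin n) (λ j → ∑-ite (does (i ≻? j)) (tuples k n) _) ⟩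
        ∑[ j ∈ allFin n ] ite (does (i ≻? j)) (∑[ I ∈ tuples k n ] ite (linked (j ∷ I)) (term x b (j ∷ I)))
          ≈⟨ ∑-cong (allFin n) (λ j → trans (reflexive (≡.cong (λ s → ite s (rest j)) (≻-does i j)))
               (ite-cong (toℕ j <ᵇ w (toℕ i)) (first k j b))) ⟩
        ∑[ j ∈ allFin n ] ite (toℕ j <ᵇ w (toℕ i)) (g (toℕ j))
          ≈⟨ ∑-below n (w (toℕ i)) (w≤ (toℕ<n i)) g ⟩
        ∑< (w (toℕ i)) g
          ≈⟨ S-sum k (w (toℕ i)) (ext x) b ⟨
        S (suc k) (w (toℕ i)) (ext x) b ∎
        where
        rest : Fin n → Carrier
        rest j = ∑[ I ∈ tuples k n ] ite (linked (j ∷ I)) (term x b (j ∷ I))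
        g : ℕ → Carrier
        g l = (ext x l - b (+ suc l)) * S k (w l) (ext x) (b ∘ t)

      sum≈S : ∀ k b → ∑ (filter (linked? _≻?_) (tuples k n)) (term x b) ≈ S k n (ext x) b
      sum≈S zero    b = +-identityʳ 1#
      sum≈S (suc k) b = begin
        ∑ (filter (linked? _≻?_) (tuples (suc k) n)) (term x b)
          ≈⟨ ∑-filter (linked? _≻?_) (tuples (suc k) n) (term x b) ⟩
        ∑[ I ∈ tuples (suc k) n ] ite (linked I) (term x b I)
          ≈⟨ ∑-product _∷_ (allFin n) (tuples k n) _ ⟩
        ∑[ j ∈ allFin n ] ∑[ I ∈ tuples k n ] ite (linked (j ∷ I)) (term x b (j ∷ I))
          ≈⟨ ∑-cong (allFin n) (λ j → trans (first k j b) (below j)) ⟩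
        ∑[ j ∈ allFin n ] ite (toℕ j <ᵇ n) (g (toℕ j))
          ≈⟨ ∑-below n n ℕₚ.≤-refl g ⟩
        ∑< n g
          ≈⟨ S-sum k n (ext x) b ⟨
        S (suc k) n (ext x) b ∎
        where
        g : ℕ → Carrier
        g l = (ext x l - b (+ suc l)) * S k (w l) (ext x) (b ∘ t)
        below : ∀ j → g (toℕ j) ≈ ite (toℕ j <ᵇ n) (g (toℕ j))
        below j = ite-true (toℕ j <ᵇ n) (ℕₚ.<⇒<ᵇ (toℕ<n j))

  shift⁺ : ∀ i j → i ℤ.+ + suc j ≡ i ℤ.+ + j ℤ.+ 1ℤ
  shift⁺ i j = ≡.trans (≡.cong (λ s → i ℤ.+ s) (ℤₚ.+-comm 1ℤ (+ j))) (≡.sym (ℤₚ.+-assoc i (+ j) 1ℤ))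

  module E = Recursion id (ℤ._+ 1ℤ) (λ i j → i ℤ.+ + j) ℤₚ.+-identityʳ shift⁺

  shift⁻ : ∀ i j → i ℤ.- + suc j ≡ i ℤ.- + j ℤ.- 1ℤ
  shift⁻ i j = ≡.trans (≡.cong (λ s → i ℤ.+ s) (≡.trans (ℤₚ.neg-distrib-+ 1ℤ (+ j)) (ℤₚ.+-comm -1ℤ (ℤ.- + j))))
                       (≡.sym (ℤₚ.+-assoc i (ℤ.- + j) -1ℤ))

  module H = Recursion suc (ℤ._- 1ℤ) (λ i j → i ℤ.- + j) ℤₚ.+-identityʳ shift⁻

  eSum≈S : ∀ {n} k (x : Fin n → Carrier) b → eSum k x b ≈ E.S k n (ext x) b
  eSum≈S k x b = E.sum≈S ℕₚ.<⇒≤ (λ i j → j <F? i) (λ i j → ≡.refl) x k b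

  hSum≈S : ∀ {n} k (x : Fin n → Carrier) b → hSum k x b ≈ H.S k n (ext x) b
  hSum≈S k x b = H.sum≈S id (λ i j → j ≤F? i) (λ i j → ≤<ᵇ (toℕ j) (toℕ i)) x k b
    where
    ≤<ᵇ : ∀ m n → (m ℕ.≤ᵇ n) ≡ (m <ᵇ suc n)
    ≤<ᵇ zero    n = ≡.refl
    ≤<ᵇ (suc m) n = ≡.refl

  eList hList : ℕ → List Carrier → (ℤ → Carrier) → Carrier
  eList zero    ys       b = 1#
  eList (suc k) []       b = 0#
  eList (suc k) (y ∷ ys) b = eList (suc k) ys b + (y - b (+ suc (length ys))) * eList k ys (b ∘ (ℤ._+ 1ℤ))
  hList zero    ys       b = 1#
  hList (suc k) []       b = 0#
  hList (suc k) (y ∷ ys) b = hList (suc k) ys b + (y - b (+ suc (length ys))) * hList k (y ∷ ys) (b ∘ (ℤ._- 1ℤ))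

  ES≈eList : ∀ k m y b → E.S k m y b ≈ eList k (applyDownFrom y m) b
  ES≈eList zero    m       y b = refl
  ES≈eList (suc k) zero    y b = refl
  ES≈eList (suc k) (suc m) y b = +-cong (ES≈eList (suc k) m y b)
    (*-cong (reflexive (≡.cong (λ l → y m - b (+ suc l)) (≡.sym (length-applyDownFrom y m)))) (ES≈eList k m y _))

  HS≈hList : ∀ k m y b → H.S k m y b ≈ hList k (applyDownFrom y m) b
  HS≈hList zero    m       y b = refl
  HS≈hList (suc k) zero    y b = refl
  HS≈hList (suc k) (suc m) y b = +-cong (HS≈hList (suc k) m y b)
    (*-cong (reflexive (≡.cong (λ l → y m - b (+ suc l)) (≡.sym (length-applyDownFrom y m)))) (HS≈hList k (suc m) y _))

  eList-swap : ∀ x y zs k b → eList k (x ∷ y ∷ zs) b ≈ eList k (y ∷ x ∷ zs) b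
  eList-swap x y zs zero          b = refl
  eList-swap x y zs (suc zero)    b =
    solve 6 (λ a x y u v i → a :+ (y :+ v) :* i :+ (x :+ u) :* i := a :+ (x :+ v) :* i :+ (y :+ u) :* i)
      refl (eList 1 zs b) x y (- b (+ suc (suc (length zs)))) (- b (+ suc (length zs))) 1#
  eList-swap x y zs (suc (suc k)) b = begin
    a + (y - b₁) * p + (x - b₂) * (p + (y - b₂′) * q)
      ≈⟨ +-congˡ (*-congˡ (+-congˡ (*-congʳ (+-congˡ (-‿cong b₂′≈b₂))))) ⟩
    a + (y - b₁) * p + (x - b₂) * (p + (y - b₂) * q)
      ≈⟨ solve 7 (λ a p q x y u v → a :+ (y :+ v) :* p :+ (x :+ u) :* (p :+ (y :+ u) :* q)
                                 := a :+ (x :+ v) :* p :+ (y :+ u) :* (p :+ (x :+ u) :* q))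
           refl a p q x y (- b₂) (- b₁) ⟩
    a + (x - b₁) * p + (y - b₂) * (p + (x - b₂) * q)
      ≈⟨ +-congˡ (*-congˡ (+-congˡ (*-congʳ (+-congˡ (-‿cong b₂′≈b₂))))) ⟨
    a + (x - b₁) * p + (y - b₂) * (p + (x - b₂′) * q) ∎
    where
    n = length zs
    b₁ = b (+ suc n)
    b₂ = b (+ suc (suc n))
    b₂′ = b (+ suc n ℤ.+ 1ℤ)
    a = eList (suc (suc k)) zs b
    p = eList (suc k) zs (b ∘ (ℤ._+ 1ℤ))
    q = eList k zs (b ∘ (ℤ._+ 1ℤ) ∘ (ℤ._+ 1ℤ))
    b₂′≈b₂ : b₂′ ≈ b₂
    b₂′≈b₂ = reflexive (≡.cong (λ m → b (+ m)) (ℕₚ.+-comm (suc n) 1))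

  module _ (x y : Carrier) (zs : List Carrier) where
    private
      c : (ℤ → Carrier) → Carrier
      c b = b (+ suc (suc (length zs)))

      exchange : ∀ {c c′ u v w} →
                 (x - c′) * u + (y - c′) * v ≈ (y - c′) * u + (x - c′) * w →
                 (y - c′) * v + (x - c) * u ≈ (y - c) * u + (x - c′) * w
      exchange {c} {c′} {u} {v} {w} ih = +-cancelʳ ((x - c′) * u) _ _ (begin
        (y - c′) * v + (x - c) * u + (x - c′) * u
          ≈⟨ solve 3 (λ p q r → p :+ q :+ r := q :+ (r :+ p)) refl _ _ _ ⟩
        (x - c) * u + ((x - c′) * u + (y - c′) * v)
          ≈⟨ +-congˡ ih ⟩
        (x - c) * u + ((y - c′) * u + (x - c′) * w)
          ≈⟨ solve 6 (λ x y c d u r → (x :+ c) :* u :+ ((y :+ d) :* u :+ r) := (y :+ c) :* u :+ r :+ (x :+ d) :* u)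
               refl x y (- c) (- c′) u ((x - c′) * w) ⟩
        (y - c) * u + (x - c′) * w + (x - c′) * u ∎)

    -- Equivalent to the divided-difference formula, with n variables x, y, zs:
    -- (x - y) h_k(x,y,zs) = (x - b_n) h_k(x,zs) - (y - b_n) h_k(y,zs).
    hList-divided : ∀ k b →
      (x - c b) * hList k (x ∷ y ∷ zs) b + (y - c b) * hList k (y ∷ zs) b ≈
      (y - c b) * hList k (x ∷ y ∷ zs) b + (x - c b) * hList k (x ∷ zs) b
    hList-divided zero    b = +-comm _ _
    hList-divided (suc k) b = begin
      X * (h₀ + Y′ * v + X * u) + Y * (h₀ + Y′ * v)
        ≈⟨ solve 5 (λ h X Y s t → X :* (h :+ s :+ t) :+ Y :* (h :+ s) := X :* h :+ X :* (s :+ t) :+ Y :* (h :+ s))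
             refl h₀ X Y (Y′ * v) (X * u) ⟩
      X * h₀ + X * (Y′ * v + X * u) + Y * (h₀ + Y′ * v)
        ≈⟨ +-congʳ (+-congˡ (*-congˡ (exchange (hList-divided k b′)))) ⟩
      X * h₀ + X * (Y * u + X′ * w) + Y * (h₀ + Y′ * v)
        ≈⟨ solve 6 (λ h X Y s u r → X :* h :+ X :* (Y :* u :+ r) :+ Y :* (h :+ s) := Y :* (h :+ s :+ X :* u) :+ X :* (h :+ r))
             refl h₀ X Y (Y′ * v) u (X′ * w) ⟩
      Y * (h₀ + Y′ * v + X * u) + X * (h₀ + X′ * w) ∎
      where
      b′ = b ∘ (ℤ._- 1ℤ)
      X = x - c b
      Y = y - c b
      X′ = x - c b′
      Y′ = y - c b′
      h₀ = hList (suc k) zs b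
      u = hList k (x ∷ y ∷ zs) b′
      v = hList k (y ∷ zs) b′
      w = hList k (x ∷ zs) b′

    hList-swap : ∀ k b → hList k (x ∷ y ∷ zs) b ≈ hList k (y ∷ x ∷ zs) b
    hList-swap zero    b = refl
    hList-swap (suc k) b = begin
      h₀ + Y′ * v + X * u       ≈⟨ +-assoc _ _ _ ⟩
      h₀ + (Y′ * v + X * u)     ≈⟨ +-congˡ (exchange (hList-divided k b′)) ⟩
      h₀ + (Y * u + X′ * w)     ≈⟨ +-congˡ (+-comm _ _) ⟩
      h₀ + (X′ * w + Y * u)     ≈⟨ +-assoc _ _ _ ⟨
      h₀ + X′ * w + Y * u       ≈⟨ +-congˡ (*-congˡ (hList-swap k b′)) ⟩
      h₀ + X′ * w + Y * hList k (y ∷ x ∷ zs) b′ ∎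
      where
      b′ = b ∘ (ℤ._- 1ℤ)
      X = x - c b
      Y = y - c b
      X′ = x - c b′
      Y′ = y - c b′
      h₀ = hList (suc k) zs b
      u = hList k (x ∷ y ∷ zs) b′
      v = hList k (y ∷ zs) b′
      w = hList k (x ∷ zs) b′

  eList-prep : ∀ y {ys zs} → length ys ≡ length zs → (∀ k b → eList k ys b ≈ eList k zs b) →
               ∀ k b → eList k (y ∷ ys) b ≈ eList k (y ∷ zs) b
  eList-prep y l e zero    b = refl
  eList-prep y l e (suc k) b =
    +-cong (e (suc k) b) (*-cong (reflexive (≡.cong (λ m → y - b (+ suc m)) l)) (e k _))

  hList-prep : ∀ y {ys zs} → length ys ≡ length zs → (∀ k b → hList k ys b ≈ hList k zs b) →
               ∀ k b → hList k (y ∷ ys) b ≈ hList k (y ∷ zs) b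
  hList-prep y l e zero    b = refl
  hList-prep y l e (suc k) b =
    +-cong (e (suc k) b) (*-cong (reflexive (≡.cong (λ m → y - b (+ suc m)) l)) (hList-prep y l e k _))

  eList-↭ : ∀ {ys zs} → ys ↭ zs → ∀ k b → eList k ys b ≈ eList k zs b
  eList-↭ ↭.refl         k b = refl
  eList-↭ (↭.prep y p)   k b = eList-prep y (↭-length p) (eList-↭ p) k b
  eList-↭ (↭.swap x y p) k b =
    trans (eList-swap x y _ k b)
          (eList-prep y (≡.cong suc (↭-length p)) (eList-prep x (↭-length p) (eList-↭ p)) k b)
  eList-↭ (↭.trans p q)  k b = trans (eList-↭ p k b) (eList-↭ q k b)

  hList-↭ : ∀ {ys zs} → ys ↭ zs → ∀ k b → hList k ys b ≈ hList k zs b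
  hList-↭ ↭.refl         k b = refl
  hList-↭ (↭.prep y p)   k b = hList-prep y (↭-length p) (hList-↭ p) k b
  hList-↭ (↭.swap x y p) k b =
    trans (hList-swap x y _ k b)
          (hList-prep y (≡.cong suc (↭-length p)) (hList-prep x (↭-length p) (hList-↭ p)) k b)
  hList-↭ (↭.trans p q)  k b = trans (hList-↭ p k b) (hList-↭ q k b)

  applyUpTo-tabulate : ∀ {n} (x : Fin n → Carrier) f → (∀ i → f (toℕ i) ≡ x i) → applyUpTo f n ≡ tabulate x
  applyUpTo-tabulate {zero}  x f e = ≡.refl
  applyUpTo-tabulate {suc n} x f e = ≡.cong₂ _∷_ (e zero) (applyUpTo-tabulate (x ∘ suc) (f ∘ suc) (e ∘ suc))

  list-↭ : ∀ {n} (x : Fin n → Carrier) → applyDownFrom (ext x) n ↭ tabulate x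
  list-↭ {n} x = ↭-trans (↭-reflexive (≡.sym (reverse-applyUpTo (ext x) n)))
    (↭-trans (↭-reverse _) (↭-reflexive (applyUpTo-tabulate x (ext x) (ext-toℕ x))))

  tabulate-↭ : ∀ {n} (x : Fin n → Carrier) (σ : Permutation′ n) → tabulate (λ i → x (σ ⟨$⟩ʳ i)) ↭ tabulate x
  tabulate-↭ x σ = ↭-trans (↭-reflexive (≡.sym (concat-singletons _)))
    (↭-trans (↭-sym (sum-permute (λ i → x i ∷ []) σ)) (↭-reflexive (concat-singletons x)))
    where
    open import Algebra.Properties.CommutativeMonoid.Sum (++-commutativeMonoid {A = Carrier}) using (sum; sum-permute)
    concat-singletons : ∀ {n} (y : Fin n → Carrier) → sum (λ i → y i ∷ []) ≡ tabulate y
    concat-singletons {zero}  y = ≡.refl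
    concat-singletons {suc n} y = ≡.cong (y zero ∷_) (concat-singletons (y ∘ suc))

  list-permute : ∀ {n} (x : Fin n → Carrier) (σ : Permutation′ n) →
                 applyDownFrom (ext (λ i → x (σ ⟨$⟩ʳ i))) n ↭ applyDownFrom (ext x) n
  list-permute x σ = ↭-trans (list-↭ _) (↭-trans (tabulate-↭ x σ) (↭-sym (list-↭ x)))

  eSum≈eList : ∀ {n} k (x : Fin n → Carrier) b → eSum k x b ≈ eList k (applyDownFrom (ext x) n) b
  eSum≈eList {n} k x b = trans (eSum≈S k x b) (ES≈eList k n (ext x) b)

  hSum≈hList : ∀ {n} k (x : Fin n → Carrier) b → hSum k x b ≈ hList k (applyDownFrom (ext x) n) b
  hSum≈hList {n} k x b = trans (hSum≈S k x b) (HS≈hList k n (ext x) b)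

  eSum-permute : ∀ {n} k (x : Fin n → Carrier) b (σ : Permutation′ n) →
                 eSum k (λ i → x (σ ⟨$⟩ʳ i)) b ≈ eSum k x b
  eSum-permute k x b σ = trans (eSum≈eList k _ b)
    (trans (eList-↭ (list-permute x σ) k b) (sym (eSum≈eList k x b)))

  hSum-permute : ∀ {n} k (x : Fin n → Carrier) b (σ : Permutation′ n) →
                 hSum k (λ i → x (σ ⟨$⟩ʳ i)) b ≈ hSum k x b
  hSum-permute k x b σ = trans (hSum≈hList k _ b)
    (trans (hList-↭ (list-permute x σ) k b) (sym (hSum≈hList k x b)))

  ext-last : ∀ {n} (x : Fin n → Carrier) v → ext (insertAt x (fromℕ n) v) n ≡ v
  ext-last {n} x v = ≡.trans (≡.cong (ext (insertAt x (fromℕ n) v)) (≡.sym (toℕ-fromℕ n)))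
    (≡.trans (ext-toℕ (insertAt x (fromℕ n) v) (fromℕ n)) (at n x))
    where
    at : ∀ n (x : Fin n → Carrier) → insertAt x (fromℕ n) v (fromℕ n) ≡ v
    at zero    x = ≡.refl
    at (suc n) x = at n (x ∘ suc)

  ext-init : ∀ {n} (x : Fin n → Carrier) v {m} → m < n → ext (insertAt x (fromℕ n) v) m ≡ ext x m
  ext-init {n} x v {m} m<n = begin′
    where
    i = fromℕ< m<n
    m≡ : toℕ i ≡ m
    m≡ = toℕ-fromℕ< m<n
    at : ∀ {n} (x : Fin n → Carrier) i → insertAt x (fromℕ n) v (inject₁ i) ≡ x i
    at x zero    = ≡.refl
    at x (suc i) = at (x ∘ suc) i
    begin′ : ext (insertAt x (fromℕ n) v) m ≡ ext x m
    begin′ = ≡.trans (≡.cong (ext (insertAt x (fromℕ n) v)) (≡.sym (≡.trans (toℕ-inject₁ i) m≡)))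
      (≡.trans (ext-toℕ (insertAt x (fromℕ n) v) (inject₁ i))
      (≡.trans (at x i) (≡.trans (≡.sym (ext-toℕ x i)) (≡.cong (ext x) m≡))))

  private
    dropLast : ∀ p {c d q} → c ≈ d → p + (c - d) * q ≈ p
    dropLast p {c} {d} {q} e = trans (+-congˡ (trans (*-congʳ (trans (+-congʳ e) (-‿inverseʳ d))) (zeroˡ q))) (+-identityʳ p)

  eSum-stable : ∀ {n} k (x : Fin n → Carrier) b → eSum k (insertAt x (fromℕ n) (b (+ suc n))) b ≈ eSum k x b
  eSum-stable     zero    x b = refl
  eSum-stable {n} (suc k) x b = begin
    eSum (suc k) x′ b                  ≈⟨ eSum≈S (suc k) x′ b ⟩
    E.S (suc k) (suc n) (ext x′) b    ≈⟨ dropLast _ (reflexive (ext-last x v)) ⟩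
    E.S (suc k) n (ext x′) b          ≈⟨ E.S-cong ℕₚ.<⇒≤ (suc k) n b ℕₚ.≤-refl (λ l → reflexive (ext-init x v l)) ⟩
    E.S (suc k) n (ext x) b           ≈⟨ eSum≈S (suc k) x b ⟨
    eSum (suc k) x b                   ∎
    where
    v = b (+ suc n)
    x′ = insertAt x (fromℕ n) v

  hSum-stable : ∀ {n} k (x : Fin n → Carrier) b → hSum k (insertAt x (fromℕ n) (b (+ suc n))) b ≈ hSum k x b
  hSum-stable     zero    x b = refl
  hSum-stable {n} (suc k) x b = begin
    hSum (suc k) x′ b                  ≈⟨ hSum≈S (suc k) x′ b ⟩
    H.S (suc k) (suc n) (ext x′) b    ≈⟨ dropLast _ (reflexive (ext-last x v)) ⟩
    H.S (suc k) n (ext x′) b          ≈⟨ H.S-cong id (suc k) n b ℕₚ.≤-refl (λ l → reflexive (ext-init x v l)) ⟩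
    H.S (suc k) n (ext x) b           ≈⟨ hSum≈S (suc k) x b ⟨
    hSum (suc k) x b                   ∎
    where
    v = b (+ suc n)
    x′ = insertAt x (fromℕ n) v

module Coeff = Polynomials ℚ-commutativeRing

ℚ[a] : CommutativeRing 0ℓ 0ℓ
ℚ[a] = Coeff.polynomialRing ℤ

module ℚ[a] = CommutativeRing ℚ[a]

-- ℚ[a′] is not a separate ring: under its identification with ℚ[a] the
-- sequence a′ is a sequence of elements of ℚ[a].
a a′ : ℤ → ℚ[a].Carrier
a  i = Coeff.var i
a′ i = ℚ[a].- a (ℤ.- i ℤ.+ 1ℤ)

open Polynomials ℚ[a] public

record Λ (b : ℤ → ℚ[a].Carrier) : Set where
  field
    component : (n : ℕ) → Poly (Fin n)
    symmetric : ∀ n → Symmetric (component n)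
    bounded   : ∃ λ d → ∀ n → TotalDegree≤ d (component n)
    stable    : ∀ n → substitute (insertAt var (fromℕ n) (con (b (+ suc n)))) (component (suc n)) ≋ component n

open Λ public

infix 4 _≈Λ_

_≈Λ_ : ∀ {b} → Rel (Λ b) 0ℓ
P ≈Λ Q = ∀ n → component P n ≋ component Q n

ΛRing : (ℤ → ℚ[a].Carrier) → CommutativeRing 0ℓ 0ℓ
ΛRing b = record
  { Carrier = Λ b
  ; _≈_     = _≈Λ_
  ; _+_     = λ P Q → record
    { component = λ n → component P n ⊕ component Q n
    ; symmetric = λ n σ → ⊕-cong (symmetric P n σ) (symmetric Q n σ)
    ; bounded   = proj₁ (bounded P) ⊔ proj₁ (bounded Q) , λ n → deg-⊕
                    (deg-mono (ℕₚ.m≤m⊔n _ _) (proj₂ (bounded P) n))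
                    (deg-mono (ℕₚ.m≤n⊔m (proj₁ (bounded P)) _) (proj₂ (bounded Q) n))
    ; stable    = λ n → ⊕-cong (stable P n) (stable Q n)
    }
  ; _*_     = λ P Q → record
    { component = λ n → component P n ⊗ component Q n
    ; symmetric = λ n σ → ⊗-cong (symmetric P n σ) (symmetric Q n σ)
    ; bounded   = proj₁ (bounded P) ℕ.+ proj₁ (bounded Q) , λ n → deg-⊗ (proj₂ (bounded P) n) (proj₂ (bounded Q) n)
    ; stable    = λ n → ⊗-cong (stable P n) (stable Q n)
    }
  ; -_      = λ P → record
    { component = λ n → ⊖ component P n
    ; symmetric = λ n σ → ⊖-cong (symmetric P n σ)
    ; bounded   = proj₁ (bounded P) , λ n → deg-⊖ (proj₂ (bounded P) n)
    ; stable    = λ n → ⊖-cong (stable P n)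
    }
  ; 0#      = constant ℚ[a].0#
  ; 1#      = constant ℚ[a].1#
  ; isCommutativeRing = record
    { isRing = record
      { +-isAbelianGroup = record
        { isGroup = record
          { isMonoid = record
            { isSemigroup = record
              { isMagma = record
                { isEquivalence = record
                  { refl  = λ n → ≋-refl
                  ; sym   = λ e n → ≋-sym (e n)
                  ; trans = λ d e n → ≋-trans (d n) (e n)
                  }
                ; ∙-cong = λ d e n → ⊕-cong (d n) (e n)
                }
              ; assoc = λ P Q R n → ⊕-assoc _ _ _
              }
            ; identity = (λ P n → R.+-identityˡ n _) , λ P n → R.+-identityʳ n _
            }
          ; inverse = (λ P n → R.-‿inverseˡ n _) , λ P n → R.-‿inverseʳ n _
          ; ⁻¹-cong = λ e n → ⊖-cong (e n)
          }
        ; comm = λ P Q n → ⊕-comm _ _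
        }
      ; *-cong     = λ d e n → ⊗-cong (d n) (e n)
      ; *-assoc    = λ P Q R n → ⊗-assoc _ _ _
      ; *-identity = (λ P n → R.*-identityˡ n _) , λ P n → R.*-identityʳ n _
      ; distrib    = (λ P Q R n → ⊗-distrib _ _ _) , λ P Q R n → R.distribʳ n _ _ _
      }
    ; *-comm = λ P Q n → ⊗-comm _ _
    }
  }
  where
  open Degree
  module R n = CommutativeRing (polynomialRing (Fin n))
  constant : ℚ[a].Carrier → Λ b
  constant c = record
    { component = λ n → con c
    ; symmetric = λ n σ → ≋-refl
    ; bounded   = 0 , λ n → deg-con c
    ; stable    = λ n → ≋-refl
    }

_·_ : ∀ {b} → Opₗ ℚ[a].Carrier (Λ b)
c · P = record
  { component = λ n → con c ⊗ component P n
  ; symmetric = λ n σ → ⊗-cong ≋-refl (symmetric P n σ)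
  ; bounded   = proj₁ (bounded P) , λ n → deg-⊗ (deg-con c) (proj₂ (bounded P) n)
  ; stable    = λ n → ⊗-cong ≋-refl (stable P n)
  }
  where open Degree

infixr 7 _·_

module Sums (n : ℕ) = DoubleSums (polynomialRing (Fin n))

module _ {n m : ℕ} (f : Fin n → Poly (Fin m)) where
  private
    module N = BigOps (polynomialRing (Fin n))
    module M = BigOps (polynomialRing (Fin m))

  substitute-∑ : {X : Set} (xs : List X) {g : X → Poly (Fin n)} {g′ : X → Poly (Fin m)} →
                 (∀ x → substitute f (g x) ≡ g′ x) → substitute f (N.∑ xs g) ≡ M.∑ xs g′
  substitute-∑ []       h = ≡.refl
  substitute-∑ (x ∷ xs) h = ≡.cong₂ _⊕_ (h x) (substitute-∑ xs h)

  substitute-∏ : ∀ k {g : Fin k → Poly (Fin n)} {g′ : Fin k → Poly (Fin m)} →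
                 (∀ i → substitute f (g i) ≡ g′ i) → substitute f (N.∏ k g) ≡ M.∏ k g′
  substitute-∏ zero    h = ≡.refl
  substitute-∏ (suc k) h = ≡.cong₂ _⊗_ (h zero) (substitute-∏ k (h ∘ suc))

  substitute-eSum : ∀ k b → substitute f (Sums.eSum n k var (con ∘ b)) ≡ Sums.eSum m k f (con ∘ b)
  substitute-eSum k b = substitute-∑ (filter (linked? _) (tuples k n)) λ I → substitute-∏ k λ j → ≡.refl

  substitute-hSum : ∀ k b → substitute f (Sums.hSum n k var (con ∘ b)) ≡ Sums.hSum m k f (con ∘ b)
  substitute-hSum k b = substitute-∑ (filter (linked? _) (tuples k n)) λ I → substitute-∏ k λ j → ≡.refl

e h : (b : ℤ → ℚ[a].Carrier) → ℕ → Λ b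
e b k = record
  { component = λ n → Sums.eSum n k var (con ∘ b)
  ; symmetric = λ n σ → ≋-trans (R.reflexive n (substitute-eSum _ k b)) (Sums.eSum-permute n k var (con ∘ b) σ)
  ; bounded   = k , λ n → deg-∑ (filter (linked? _) (tuples k n)) λ I →
                  deg-∏ k λ j → deg-⊕ (deg-var (lookup I j)) (deg-⊖ (deg-con _))
  ; stable    = λ n → ≋-trans (R.reflexive n (substitute-eSum _ k b)) (Sums.eSum-stable n k var (con ∘ b))
  }
  where
  open Degree
  module R n = CommutativeRing (polynomialRing (Fin n))
h b k = record
  { component = λ n → Sums.hSum n k var (con ∘ b)
  ; symmetric = λ n σ → ≋-trans (R.reflexive n (substitute-hSum _ k b)) (Sums.hSum-permute n k var (con ∘ b) σ)
  ; bounded   = k , λ n → deg-∑ (filter (linked? _) (tuples k n)) λ I →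
                  deg-∏ k λ j → deg-⊕ (deg-var (lookup I j)) (deg-⊖ (deg-con _))
  ; stable    = λ n → ≋-trans (R.reflexive n (substitute-hSum _ k b)) (Sums.hSum-stable n k var (con ∘ b))
  }
  where
  open Degree
  module R n = CommutativeRing (polynomialRing (Fin n))

record Partition : Set where
  field
    parts      : List ℕ
    decreasing : Linked _≥_ parts
    positive   : All (0 <_) parts

eProduct hProduct : (b : ℤ → ℚ[a].Carrier) → Partition → Λ b
eProduct b μ = foldr _*_ 1# (map (e b) (Partition.parts μ))
  where open CommutativeRing (ΛRing b)
hProduct b μ = foldr _*_ 1# (map (h b) (Partition.parts μ))
  where open CommutativeRing (ΛRing b)

-- The map ω : Λ(x‖b) → Λ(x‖c).  With (b , c) = (a , a′) this
-- characterises ω_a; with (b , c) = (a′ , a) it characterises ω_{a′},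
-- since (a′)′ = a.
record IsOmega (b c : ℤ → ℚ[a].Carrier) (ω : Λ b → Λ c) : Set where
  private
    module B = CommutativeRing (ΛRing b)
    module C = CommutativeRing (ΛRing c)
  open RingMorphisms B.rawRing C.rawRing using (IsRingHomomorphism)
  field
    isRingHomomorphism : IsRingHomomorphism ω
    linear             : Homomorphicₗ ℚ[a].Carrier (Λ b) (Λ c) _≈Λ_ ω _·_ _·_
    e↦h                : ∀ k → 1 ≤ k → ω (e b k) ≈Λ h c k

module Submission where

-- Write U_k(t) = t^k / ∏_{0 ≤ l ≤ k} (1 - b_{1-l} t) and V_k(t) = t^k / ∏_{0 ≤ l ≤ k} (1 - b_l t).
-- Up to factors independent of x, the series Σ_k h_k(x‖b) U_k and
-- Σ_k (-1)^k e_k(x‖b) V_k are ∏ (1 - b_i t)/(1 - x_i t) and its inverse, so their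
-- product does not depend on x.  Applying ω, and comparing with the same
-- relation for c = b′ after t ↦ -t, which interchanges the roles of the two
-- node sequences, identifies ω(h_k(x‖b)) with e_k(x‖c).
--
-- So ω′ ∘ ω fixes every e_k, and it remains to see that the e_k generate.  If a
-- symmetric p in n variables of degree ≤ d vanishes at x_n = b_n, then it is
-- divisible by ∏ (x_i - b_n) = e_n(x_1, …, x_n‖b); hence induction on (n , d)
-- writes p as the n-th component of a polynomial in the e_k all of whose
-- components have degree ≤ d.  For p = P_d with P of degree ≤ d this
-- polynomial is P, because an element of degree ≤ d with zero d-th
-- component is zero: its n-th component for n > d is divisible by n
-- linear factors.

open import Algebra.Bundles using (CommutativeRing)
import Algebra.Morphism.Construct.Composition as Composition
open import Algebra.Morphism.Structures using (module RingMorphisms)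
import Algebra.Properties.Group
import Algebra.Properties.Ring
open import Data.Fin.Base using (Fin; zero; suc; fromℕ; punchIn; punchOut)
open import Data.Fin.Permutation as Perm using (Permutation′; _⟨$⟩ʳ_; insert-punchIn)
open import Data.Fin.Properties using (_≟_; punchInᵢ≢i; punchIn-punchOut)
open import Data.Integer.Base as ℤ using (ℤ; +_; -[1+_]; 1ℤ)
import Data.Integer.Properties as ℤₚ
open import Data.List.Base using (List; []; _∷_; length; foldr; map; allFin; tabulate; applyDownFrom)
open import Data.List.Properties using (length-tabulate; map-tabulate)
open import Data.List.Relation.Binary.Permutation.Propositional as ↭ using (_↭_)
open import Data.List.Relation.Unary.All as All using (All; []; _∷_)
open import Data.List.Relation.Unary.All.Properties using (tabulate⁺)
open import Data.List.Relation.Unary.AllPairs using ([]; _∷_)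
open import Data.List.Relation.Unary.Unique.Propositional using (Unique)
open import Data.List.Relation.Unary.Unique.Propositional.Properties using (allFin⁺)
open import Data.Maybe.Base using (Maybe; just; nothing)
open import Data.Nat.Base as ℕ using (ℕ; zero; suc; _≤_; _<_; z≤n; s≤s)
open import Data.Nat.Induction using (Acc; acc; <-wellFounded)
import Data.Nat.Properties as ℕₚ
open import Data.Product.Base using (_×_; _,_; ∃; proj₁; proj₂)
open import Data.Vec.Functional using (insertAt)
open import Data.Vec.Functional.Properties using (insertAt-lookup; insertAt-punchIn)
open import Function.Base using (_∘_; id)
open import Level using (0ℓ)
open import Relation.Binary.PropositionalEquality as ≡ using (_≡_; _≢_)
open import Relation.Nullary.Decidable using (Dec; yes; no)
open import Relation.Nullary.Negation using (contradiction)
open import Defs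
open Degree

-- A ring solver with integer coefficients.

module IntegerSolver (R : CommutativeRing 0ℓ 0ℓ) where
  open CommutativeRing R hiding (zero)
  open import Algebra.Properties.Ring ring
    using (-0#≈0#; -‿+-comm; -‿involutive; -‿distribˡ-*; -‿distribʳ-*)
  open import Algebra.Properties.CommutativeSemigroup +-commutativeSemigroup using (interchange)
  open import Algebra.Properties.Semiring.Mult.TCOptimised semiring
    using (×-homo-+; ×1-homo-*; 1+×) renaming (_×_ to _×#_)
  open import Algebra.Solver.Ring.AlmostCommutativeRing using (fromCommutativeRing; _-Raw-AlmostCommutative⟶_)
  open import Relation.Binary.Reasoning.Setoid setoid

  private
    ⟦_⟧ : ℤ → Carrier
    ⟦ + n ⟧      = n ×# 1#
    ⟦ -[1+ n ] ⟧ = - (suc n ×# 1#)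

    ⟦-⟧ : ∀ n → ⟦ ℤ.- (+ n) ⟧ ≈ - (n ×# 1#)
    ⟦-⟧ zero    = sym -0#≈0#
    ⟦-⟧ (suc n) = refl

    ⟦⊖⟧ : ∀ m n → ⟦ m ℤ.⊖ n ⟧ ≈ m ×# 1# - n ×# 1#
    ⟦⊖⟧ m       zero    = sym (trans (+-congˡ -0#≈0#) (+-identityʳ _))
    ⟦⊖⟧ zero    (suc n) = sym (+-identityˡ _)
    ⟦⊖⟧ (suc m) (suc n) = begin
      ⟦ suc m ℤ.⊖ suc n ⟧                ≡⟨ ≡.cong ⟦_⟧ (ℤₚ.[1+m]⊖[1+n]≡m⊖n m n) ⟩
      ⟦ m ℤ.⊖ n ⟧                        ≈⟨ ⟦⊖⟧ m n ⟩
      m ×# 1# - n ×# 1#                  ≈⟨ +-identityˡ _ ⟨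
      0# + (m ×# 1# - n ×# 1#)           ≈⟨ +-congʳ (-‿inverseʳ 1#) ⟨
      (1# - 1#) + (m ×# 1# - n ×# 1#)    ≈⟨ interchange _ _ _ _ ⟩
      (1# + m ×# 1#) + (- 1# - n ×# 1#)  ≈⟨ +-cong (1+× m 1#) (trans (-‿cong (1+× n 1#)) (sym (-‿+-comm _ _))) ⟨
      suc m ×# 1# - suc n ×# 1#          ∎

    ⟦+⟧ : ∀ i j → ⟦ i ℤ.+ j ⟧ ≈ ⟦ i ⟧ + ⟦ j ⟧
    ⟦+⟧ (+ m)    (+ n)    = ×-homo-+ 1# m n
    ⟦+⟧ (+ m)    -[1+ n ] = ⟦⊖⟧ m (suc n)
    ⟦+⟧ -[1+ m ] (+ n)    = trans (⟦⊖⟧ n (suc m)) (+-comm _ _)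
    ⟦+⟧ -[1+ m ] -[1+ n ] = begin
      - (suc (suc (m ℕ.+ n)) ×# 1#)  ≡⟨ ≡.cong (λ k → - (k ×# 1#)) (ℕₚ.+-suc (suc m) n) ⟨
      - ((suc m ℕ.+ suc n) ×# 1#)    ≈⟨ -‿cong (×-homo-+ 1# (suc m) (suc n)) ⟩
      - (suc m ×# 1# + suc n ×# 1#)  ≈⟨ -‿+-comm _ _ ⟨
      - (suc m ×# 1#) - suc n ×# 1#  ∎

    ⟦neg⟧ : ∀ i → ⟦ ℤ.- i ⟧ ≈ - ⟦ i ⟧
    ⟦neg⟧ (+ n)    = ⟦-⟧ n
    ⟦neg⟧ -[1+ n ] = sym (-‿involutive _)

    ⟦*⟧⁺ : ∀ m j → ⟦ + m ℤ.* j ⟧ ≈ m ×# 1# * ⟦ j ⟧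
    ⟦*⟧⁺ m (+ n)    = trans (reflexive (≡.cong ⟦_⟧ (≡.sym (ℤₚ.pos-* m n)))) (×1-homo-* m n)
    ⟦*⟧⁺ m -[1+ n ] = begin
      ⟦ + m ℤ.* -[1+ n ] ⟧       ≡⟨ ≡.cong ⟦_⟧ (ℤₚ.neg-distribʳ-* (+ m) (+ suc n)) ⟨
      ⟦ ℤ.- (+ m ℤ.* + suc n) ⟧  ≈⟨ ⟦neg⟧ (+ m ℤ.* + suc n) ⟩
      - ⟦ + m ℤ.* + suc n ⟧      ≈⟨ -‿cong (⟦*⟧⁺ m (+ suc n)) ⟩
      - (m ×# 1# * suc n ×# 1#)  ≈⟨ -‿distribʳ-* _ _ ⟩
      m ×# 1# * - (suc n ×# 1#)  ∎

    ⟦*⟧ : ∀ i j → ⟦ i ℤ.* j ⟧ ≈ ⟦ i ⟧ * ⟦ j ⟧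
    ⟦*⟧ (+ m)    j = ⟦*⟧⁺ m j
    ⟦*⟧ -[1+ m ] j = begin
      ⟦ -[1+ m ] ℤ.* j ⟧       ≡⟨ ≡.cong ⟦_⟧ (ℤₚ.neg-distribˡ-* (+ suc m) j) ⟨
      ⟦ ℤ.- (+ suc m ℤ.* j) ⟧  ≈⟨ ⟦neg⟧ (+ suc m ℤ.* j) ⟩
      - ⟦ + suc m ℤ.* j ⟧      ≈⟨ -‿cong (⟦*⟧⁺ (suc m) j) ⟩
      - (suc m ×# 1# * ⟦ j ⟧)  ≈⟨ -‿distribˡ-* _ _ ⟩
      - (suc m ×# 1#) * ⟦ j ⟧  ∎

    morphism : ℤ.+-*-rawRing -Raw-AlmostCommutative⟶ fromCommutativeRing R
    morphism = record
      { ⟦_⟧    = ⟦_⟧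
      ; +-homo = ⟦+⟧
      ; *-homo = ⟦*⟧
      ; -‿homo = ⟦neg⟧
      ; 0-homo = refl
      ; 1-homo = refl
      }

    equal? : ∀ i j → Maybe (⟦ i ⟧ ≈ ⟦ j ⟧)
    equal? i j with i ℤₚ.≟ j
    ... | yes i≡j = just (reflexive (≡.cong ⟦_⟧ i≡j))
    ... | no  _   = nothing

  open import Algebra.Solver.Ring ℤ.+-*-rawRing (fromCommutativeRing R) morphism equal?
    using (solve; _:=_; _:+_; _:*_; _:-_; :-_; con) public

-- The index reflection i ↦ 1 - i.

mirror : ℤ → ℤ
mirror i = ℤ.- i ℤ.+ 1ℤ

mirror-involutive : ∀ i → mirror (mirror i) ≡ i
mirror-involutive i = begin
  ℤ.- (ℤ.- i ℤ.+ 1ℤ) ℤ.+ 1ℤ       ≡⟨ ≡.cong (ℤ._+ 1ℤ) (ℤₚ.neg-distrib-+ (ℤ.- i) 1ℤ) ⟩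
  ℤ.- ℤ.- i ℤ.+ ℤ.- 1ℤ ℤ.+ 1ℤ     ≡⟨ ℤₚ.+-assoc (ℤ.- ℤ.- i) (ℤ.- 1ℤ) 1ℤ ⟩
  ℤ.- ℤ.- i ℤ.+ + 0               ≡⟨ ℤₚ.+-identityʳ _ ⟩
  ℤ.- ℤ.- i                       ≡⟨ ℤₚ.neg-involutive i ⟩
  i                               ∎
  where open ≡.≡-Reasoning

mirror-suc : ∀ k → mirror (+ suc k) ≡ mirror (+ k) ℤ.- 1ℤ
mirror-suc k = ≡.trans (≡.cong (ℤ._+ 1ℤ) (≡.trans (ℤₚ.neg-distrib-+ 1ℤ (+ k)) (ℤₚ.+-comm (ℤ.- 1ℤ) (ℤ.- + k))))
  (≡.trans (ℤₚ.+-assoc (ℤ.- + k) (ℤ.- 1ℤ) 1ℤ) (≡.sym (ℤₚ.+-assoc (ℤ.- + k) 1ℤ (ℤ.- 1ℤ))))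

-- Formal power series and their expansions over a sequence of nodes.

module Series (R : CommutativeRing 0ℓ 0ℓ) where
  open CommutativeRing R hiding (zero)
  open IntegerSolver R using (solve; _:=_; _:+_; _:*_; _:-_; :-_; con)
  open import Algebra.Properties.Ring ring using (+-cancelˡ)
  open import Relation.Binary.Reasoning.Setoid setoid

  Seq : Set
  Seq = ℕ → Carrier

  infix 4 _≗_
  _≗_ : Seq → Seq → Set
  f ≗ g = ∀ k → f k ≈ g k

  shift : Seq → Seq → Seq
  shift p f k = p k * f k + f (suc k)

  -- The coefficients of Σ_k f_k t^k / ∏_{0 ≤ l ≤ k} (1 - p_l t): dropping the
  -- constant term and dividing by t turns f into shift p f.
  expand : Seq → Seq → Seq
  expand p f zero    = f 0
  expand p f (suc m) = expand p (shift p f) m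

  infixl 7 _⊛_
  _⊛_ : Seq → Seq → Seq
  (f ⊛ g) zero    = f 0 * g 0
  (f ⊛ g) (suc m) = f 0 * g (suc m) + (f ∘ suc ⊛ g) m

  -- The coefficients of (1 - x t) F, where F is the generating series of `f`.
  linear : Carrier → Seq → Seq
  linear x f zero    = f 0
  linear x f (suc m) = f (suc m) - x * f m

  alternate : Seq → Seq
  alternate f zero    = f 0
  alternate f (suc k) = - alternate (f ∘ suc) k

  shift-cong : ∀ {p q f g} → p ≗ q → f ≗ g → shift p f ≗ shift q g
  shift-cong d e k = +-cong (*-cong (d k) (e k)) (e (suc k))

  expand-cong : ∀ {p q f g} → p ≗ q → f ≗ g → expand p f ≗ expand q g
  expand-cong d e zero    = e 0
  expand-cong d e (suc m) = expand-cong d (shift-cong d e) m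

  ⊛-cong : ∀ {f f′ g g′} → f ≗ f′ → g ≗ g′ → f ⊛ g ≗ f′ ⊛ g′
  ⊛-cong d e zero    = *-cong (d 0) (e 0)
  ⊛-cong d e (suc m) = +-cong (*-cong (d 0) (e (suc m))) (⊛-cong (d ∘ suc) e m)

  linear-cong : ∀ x {f g} → f ≗ g → linear x f ≗ linear x g
  linear-cong x e zero    = e 0
  linear-cong x e (suc m) = +-cong (e (suc m)) (-‿cong (*-congˡ (e m)))

  alternate-cong : ∀ {f g} → f ≗ g → alternate f ≗ alternate g
  alternate-cong e zero    = e 0
  alternate-cong e (suc k) = -‿cong (alternate-cong (e ∘ suc) k)

  alternate-neg : ∀ f k → alternate (λ l → - f l) k ≈ - alternate f k
  alternate-neg f zero    = refl
  alternate-neg f (suc k) = -‿cong (alternate-neg (f ∘ suc) k)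

  alternate-+ : ∀ f g k → alternate (λ l → f l + g l) k ≈ alternate f k + alternate g k
  alternate-+ f g zero    = refl
  alternate-+ f g (suc k) = trans (-‿cong (alternate-+ (f ∘ suc) (g ∘ suc) k))
    (solve 2 (λ x y → :- (x :+ y) := :- x :+ :- y) refl _ _)

  alternate-* : ∀ p f k → alternate (λ l → p l * f l) k ≈ p k * alternate f k
  alternate-* p f zero    = refl
  alternate-* p f (suc k) = trans (-‿cong (alternate-* (p ∘ suc) (f ∘ suc) k))
    (solve 2 (λ x y → :- (x :* y) := x :* :- y) refl _ _)

  alternate-involutive : ∀ f → alternate (alternate f) ≗ f
  alternate-involutive f zero    = refl
  alternate-involutive f (suc k) = trans (-‿cong (alternate-neg (alternate (f ∘ suc)) k))
    (trans (solve 1 (λ x → :- :- x := x) refl _) (alternate-involutive (f ∘ suc) k))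

  expand-+ : ∀ p f g m → expand p (λ k → f k + g k) m ≈ expand p f m + expand p g m
  expand-+ p f g zero    = refl
  expand-+ p f g (suc m) = trans
    (expand-cong (λ _ → refl)
      (λ k → solve 5 (λ p x y u v → p :* (x :+ y) :+ (u :+ v) := (p :* x :+ u) :+ (p :* y :+ v)) refl _ _ _ _ _) m)
    (expand-+ p (shift p f) (shift p g) m)

  expand-* : ∀ p c f m → expand p (λ k → c * f k) m ≈ c * expand p f m
  expand-* p c f zero    = refl
  expand-* p c f (suc m) = trans
    (expand-cong (λ _ → refl) (λ k → solve 4 (λ p c x y → p :* (c :* x) :+ c :* y := c :* (p :* x :+ y)) refl _ _ _ _) m)
    (expand-* p c (shift p f) m)

  expand-neg : ∀ p f m → expand p (λ k → - f k) m ≈ - expand p f m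
  expand-neg p f zero    = refl
  expand-neg p f (suc m) = trans
    (expand-cong (λ _ → refl) (λ k → solve 3 (λ p x y → p :* :- x :+ :- y := :- (p :* x :+ y)) refl _ _ _) m)
    (expand-neg p (shift p f) m)

  -- Replacing t by -t in t^k / ∏ (1 - p_l t) produces the sign (-1)^k and negates every node.
  expand-alternate : ∀ p f → expand (λ k → - p k) (alternate f) ≗ alternate (expand p f)
  expand-alternate p f zero    = refl
  expand-alternate p f (suc m) = begin
    expand (λ k → - p k) (shift (λ k → - p k) (alternate f)) m
      ≈⟨ expand-cong (λ _ → refl) (λ k → trans
           (solve 3 (λ p x y → :- p :* x :+ :- y := :- (p :* x :+ y)) refl _ _ _)
           (-‿cong (sym (trans (alternate-+ _ _ k) (+-congʳ (alternate-* p f k)))))) m ⟩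
    expand (λ k → - p k) (λ k → - alternate (shift p f) k) m
      ≈⟨ expand-neg _ _ m ⟩
    - expand (λ k → - p k) (alternate (shift p f)) m
      ≈⟨ -‿cong (expand-alternate p (shift p f) m) ⟩
    - alternate (expand p (shift p f)) m ∎

  -- The expansion in the p-basis is triangular with unit diagonal.
  expand-injective : ∀ p {f g} → expand p f ≗ expand p g → f ≗ g
  expand-injective p         e zero    = e 0
  expand-injective p {f} {g} e (suc k) =
    +-cancelˡ (p k * f k) _ _ (trans (expand-injective p {shift p f} {shift p g} (e ∘ suc) k)
      (+-congʳ (*-congˡ (sym (expand-injective p e k)))))

  -- Since `expand p f (suc m)` is `expand p (shift p f) m`, the coefficient of t^(m+1) in (1 - x t)
  -- F is the m-th coefficient of the expansion of `shift p f` minus x times `f`. An identity of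
  -- series thus reduces to one between expansion coefficients.
  expand-linear : ∀ p {f g} x y →
    (∀ k → shift p f k - x * f k ≈ shift p g k - y * g k) → f 0 ≈ g 0 →
    linear x (expand p f) ≗ linear y (expand p g)
  expand-linear p         x y e e₀ zero    = e₀
  expand-linear p {f} {g} x y e e₀ (suc m) = trans (sym (difference x f m))
    (trans (expand-cong (λ _ → refl) e m) (difference y g m))
    where
    difference : ∀ x f m → expand p (λ k → shift p f k - x * f k) m ≈ expand p (shift p f) m - x * expand p f m
    difference x f m = trans (expand-+ p (shift p f) _ m)
      (+-congˡ (trans (expand-neg p _ m) (-‿cong (expand-* p x f m))))

  ⊛-+ : ∀ f f′ g m → ((λ k → f k + f′ k) ⊛ g) m ≈ (f ⊛ g) m + (f′ ⊛ g) m
  ⊛-+ f f′ g zero    = distribʳ _ _ _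
  ⊛-+ f f′ g (suc m) = trans (+-congˡ (⊛-+ (f ∘ suc) (f′ ∘ suc) g m))
    (solve 5 (λ x y z u v → (x :+ y) :* z :+ (u :+ v) := (x :* z :+ u) :+ (y :* z :+ v)) refl _ _ _ _ _)

  ⊛-* : ∀ c f g m → ((λ k → c * f k) ⊛ g) m ≈ c * (f ⊛ g) m
  ⊛-* c f g zero    = *-assoc _ _ _
  ⊛-* c f g (suc m) = trans (+-congˡ (⊛-* c (f ∘ suc) g m))
    (solve 4 (λ c x y u → c :* x :* y :+ c :* u := c :* (x :* y :+ u)) refl _ _ _ _)

  ⊛-neg : ∀ f g m → ((λ k → - f k) ⊛ g) m ≈ - (f ⊛ g) m
  ⊛-neg f g zero    = solve 2 (λ x y → :- x :* y := :- (x :* y)) refl _ _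
  ⊛-neg f g (suc m) = trans (+-congˡ (⊛-neg (f ∘ suc) g m))
    (solve 3 (λ x y u → :- x :* y :+ :- u := :- (x :* y :+ u)) refl _ _ _)

  ⊛-linearˡ : ∀ x f g → linear x f ⊛ g ≗ linear x (f ⊛ g)
  ⊛-linearˡ x f g zero    = refl
  ⊛-linearˡ x f g (suc m) = begin
    f 0 * g (suc m) + ((λ k → f (suc k) - x * f k) ⊛ g) m
      ≈⟨ +-congˡ (trans (⊛-+ (f ∘ suc) _ g m) (+-congˡ (trans (⊛-neg _ g m) (-‿cong (⊛-* x f g m))))) ⟩
    f 0 * g (suc m) + ((f ∘ suc ⊛ g) m - x * (f ⊛ g) m)
      ≈⟨ +-assoc _ _ _ ⟨
    (f ⊛ g) (suc m) - x * (f ⊛ g) m ∎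

  ⊛-linearʳ : ∀ x f g → f ⊛ linear x g ≗ linear x (f ⊛ g)
  ⊛-linearʳ x f g zero          = refl
  ⊛-linearʳ x f g (suc zero)    =
    solve 5 (λ x f g f₁ g₁ → f :* (g₁ :- x :* g) :+ f₁ :* g := f :* g₁ :+ f₁ :* g :- x :* (f :* g)) refl _ _ _ _ _
  ⊛-linearʳ x f g (suc (suc m)) = trans (+-congˡ (⊛-linearʳ x (f ∘ suc) g (suc m)))
    (solve 6 (λ x f g g₁ u v → f :* (g₁ :- x :* g) :+ (u :- x :* v) := f :* g₁ :+ u :- x :* (f :* g :+ v))
      refl _ _ _ _ _ _)

  linear-comm : ∀ x y f → linear x (linear y f) ≗ linear y (linear x f)
  linear-comm x y f zero          = refl
  linear-comm x y f (suc zero)    =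
    solve 4 (λ x y f g → g :- y :* f :- x :* f := g :- x :* f :- y :* f) refl _ _ _ _
  linear-comm x y f (suc (suc m)) =
    solve 5 (λ x y f g h → h :- y :* g :- x :* (g :- y :* f) := h :- x :* g :- y :* (g :- x :* f)) refl _ _ _ _ _

  -- The factor 1 - x t has constant term 1, so the coefficients are recovered one after another.
  linear-injective : ∀ x {f g} → linear x f ≗ linear x g → f ≗ g
  linear-injective x         e zero    = e 0
  linear-injective x {f} {g} e (suc m) = begin
    f (suc m)                    ≈⟨ solve 2 (λ f u → f := f :- u :+ u) refl _ _ ⟩
    f (suc m) - x * f m + x * f m  ≈⟨ +-cong (e (suc m)) (*-congˡ (linear-injective x e m)) ⟩
    g (suc m) - x * g m + x * g m  ≈⟨ solve 2 (λ f u → f := f :- u :+ u) refl _ _ ⟨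
    g (suc m)                    ∎

  -- (1 - x t) F = (1 - y t) F′ and (1 - y t) G = (1 - x t) G′ imply F G = F′ G′.
  ⊛-transfer : ∀ x y {f f′ g g′} → linear x f ≗ linear y f′ → linear y g ≗ linear x g′ → f ⊛ g ≗ f′ ⊛ g′
  ⊛-transfer x y {f} {f′} {g} {g′} d e = linear-injective y (linear-injective x λ m → begin
    linear x (linear y (f ⊛ g)) m     ≈⟨ linear-cong x (⊛-linearʳ y f g) m ⟨
    linear x (f ⊛ linear y g) m       ≈⟨ ⊛-linearˡ x f _ m ⟨
    (linear x f ⊛ linear y g) m       ≈⟨ ⊛-cong d e m ⟩
    (linear y f′ ⊛ linear x g′) m     ≈⟨ ⊛-linearˡ y f′ _ m ⟩
    linear y (f′ ⊛ linear x g′) m     ≈⟨ linear-cong y (⊛-linearʳ x f′ g′) m ⟩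
    linear y (linear x (f′ ⊛ g′)) m   ≈⟨ linear-comm y x _ m ⟩
    linear x (linear y (f′ ⊛ g′)) m   ∎)

  -- A series with constant term 1 is not a zero divisor: the constant terms of `f` and `f′` agree,
  -- and removing them leaves the same hypothesis for the tails.
  ⊛-cancelʳ : ∀ {f f′} g → g 0 ≈ 1# → f ⊛ g ≗ f′ ⊛ g → f ≗ f′
  ⊛-cancelʳ {f} {f′} g g₀ e = go
    where
    head : f 0 ≈ f′ 0
    head = begin
      f 0          ≈⟨ trans (*-congˡ g₀) (*-identityʳ _) ⟨
      f 0 * g 0    ≈⟨ e 0 ⟩
      f′ 0 * g 0   ≈⟨ trans (*-congˡ g₀) (*-identityʳ _) ⟩
      f′ 0         ∎
    go : f ≗ f′
    go zero    = head
    go (suc k) = ⊛-cancelʳ {f ∘ suc} {f′ ∘ suc} g g₀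
      (λ m → +-cancelˡ (f 0 * g (suc m)) _ _ (trans (e (suc m)) (+-congʳ (*-congʳ (sym head))))) k

  ⊛-alternate : ∀ f g → alternate f ⊛ alternate g ≗ alternate (f ⊛ g)
  ⊛-alternate f g zero    = refl
  ⊛-alternate f g (suc m) = begin
    f 0 * alternate g (suc m) + ((λ k → - alternate (f ∘ suc) k) ⊛ alternate g) m
      ≈⟨ +-congˡ (trans (⊛-neg _ _ m) (-‿cong (⊛-alternate (f ∘ suc) g m))) ⟩
    f 0 * - alternate (g ∘ suc) m - alternate (f ∘ suc ⊛ g) m
      ≈⟨ solve 3 (λ x y z → x :* :- y :- z := :- (x :* y :+ z)) refl _ _ _ ⟩
    - (f 0 * alternate (g ∘ suc) m + alternate (f ∘ suc ⊛ g) m)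
      ≈⟨ -‿cong (trans (alternate-+ _ _ m) (+-congʳ (alternate-* (λ _ → f 0) (g ∘ suc) m))) ⟨
    alternate (f ⊛ g) (suc m) ∎

  -- Shift identities for the double sums, and the top elementary sum.

  open DoubleSums R using (eList; hList)

  -- The recursion of `hList` subtracts from `y` an element of b whose index counts the variables.
  -- Mixing b with its shift replaces it by b_(-k), which depends on k alone and is a node of U. The
  -- proof is mutual with `h-shift`: that one for `y ∷ ys` uses this one at the same k, and this one
  -- uses `h-shift` for `ys` and itself at smaller k.
  h-step-shifted : ∀ y ys k b →
    hList (suc k) (y ∷ ys) (b ∘ (ℤ._- 1ℤ)) ≈
    hList (suc k) ys b + (y - b (mirror (+ suc k))) * hList k (y ∷ ys) (b ∘ (ℤ._- 1ℤ))

  h-shift : ∀ ys k b →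
    hList (suc k) ys (b ∘ (ℤ._- 1ℤ)) ≈
    hList (suc k) ys b + (b (+ length ys) - b (mirror (+ suc k))) * hList k ys (b ∘ (ℤ._- 1ℤ))
  -- Without variables and for k = 0 the coefficient is b_0 - b_0.
  h-shift []       zero    b = solve 1 (λ x → con (+ 0) := con (+ 0) :+ (x :- x) :* con (+ 1)) refl (b (+ 0))
  h-shift []       (suc k) b = solve 2 (λ x y → con (+ 0) := con (+ 0) :+ (x :- y) :* con (+ 0)) refl _ _
  h-shift (y ∷ ys) k       b = trans (h-step-shifted y ys k b)
    (solve 5 (λ h y c n g → h :+ (y :- c) :* g := h :+ (y :- n) :* g :+ (n :- c) :* g) refl _ _ _ _ _)

  h-step-shifted y ys zero    b = trans (+-congʳ (h-shift ys 0 b))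
    (solve 4 (λ h y n c → h :+ (n :- c) :* con (+ 1) :+ (y :- n) :* con (+ 1) := h :+ (y :- c) :* con (+ 1)) refl _ _ _ _)
  h-step-shifted y ys (suc k) b = begin
    hList (suc (suc k)) ys b′ + (y - n) * hList (suc k) (y ∷ ys) (b′ ∘ (ℤ._- 1ℤ))
      ≈⟨ +-cong (h-shift ys (suc k) b) (*-congˡ (trans (h-step-shifted y ys k b′)
           (+-congˡ (*-congʳ (+-congˡ (-‿cong (reflexive (≡.cong b (≡.sym (mirror-suc (suc k))))))))))) ⟩
    H + (n - c) * h₁ + (y - n) * (h₁ + (y - c) * g)
      ≈⟨ solve 6 (λ H n c y h₁ g → H :+ (n :- c) :* h₁ :+ (y :- n) :* (h₁ :+ (y :- c) :* g)
                                := H :+ (y :- c) :* (h₁ :+ (y :- n) :* g)) refl H n c y h₁ g ⟩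
    H + (y - c) * (h₁ + (y - n) * g) ∎
    where
    b′ = b ∘ (ℤ._- 1ℤ)
    n  = b (+ length ys)
    c  = b (mirror (+ suc (suc k)))
    H  = hList (suc (suc k)) ys b
    h₁ = hList (suc k) ys b′
    g  = hList k (y ∷ ys) (b′ ∘ (ℤ._- 1ℤ))

  -- The counterpart of `h-shift`. It rewrites e at b through e at the shifted sequence, which is
  -- the one that the recursion of `eList` produces.
  e-shift : ∀ ys k b →
    eList (suc k) ys b ≈
    eList (suc k) ys (b ∘ (ℤ._+ 1ℤ)) + (b (+ suc (length ys)) - b (+ suc k)) * eList k ys (b ∘ (ℤ._+ 1ℤ))
  e-shift []       zero    b = solve 1 (λ x → con (+ 0) := con (+ 0) :+ (x :- x) :* con (+ 1)) refl (b (+ 1))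
  e-shift []       (suc k) b = solve 2 (λ x y → con (+ 0) := con (+ 0) :+ (x :- y) :* con (+ 0)) refl _ _
  e-shift (y ∷ ys) zero    b = trans (+-congʳ (e-shift ys zero b))
    (trans (solve 5 (λ E y n c m → E :+ (n :- c) :* con (+ 1) :+ (y :- n) :* con (+ 1)
                                := E :+ (y :- m) :* con (+ 1) :+ (m :- c) :* con (+ 1)) refl _ _ _ _ (b (+ suc (suc (length ys)))))
      (+-congʳ (+-congˡ (*-congʳ (+-congˡ (-‿cong (reflexive (≡.cong (b ∘ +_) (ℕₚ.+-comm 1 (suc (length ys)))))))))))
  e-shift (y ∷ ys) (suc k) b = begin
    eList (suc (suc k)) ys b + (y - n) * eList (suc k) ys b′
      ≈⟨ +-cong (e-shift ys (suc k) b) (*-congˡ e₁≈) ⟩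
    E + (n - c) * eList (suc k) ys b′ + (y - n) * (e₁ + (m - c) * e₀)
      ≈⟨ +-congʳ (+-congˡ (*-congˡ e₁≈)) ⟩
    E + (n - c) * (e₁ + (m - c) * e₀) + (y - n) * (e₁ + (m - c) * e₀)
      ≈⟨ solve 7 (λ E n c y m e₁ e₀ →
           E :+ (n :- c) :* (e₁ :+ (m :- c) :* e₀) :+ (y :- n) :* (e₁ :+ (m :- c) :* e₀)
           := E :+ (y :- m) :* e₁ :+ (m :- c) :* (e₁ :+ (m :- c) :* e₀ :+ (y :- m) :* e₀)) refl E n c y m e₁ e₀ ⟩
    E + (y - m) * e₁ + (m - c) * (e₁ + (m - c) * e₀ + (y - m) * e₀)
      ≈⟨ +-cong (+-congˡ (*-congʳ (+-congˡ (-‿cong m≈)))) (*-congˡ (+-cong (sym e₁≈) (*-congʳ (+-congˡ (-‿cong m≈))))) ⟩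
    E + (y - b′ (+ suc (length ys))) * e₁ + (m - c) * (eList (suc k) ys b′ + (y - b′ (+ suc (length ys))) * e₀) ∎
    where
    b′ = b ∘ (ℤ._+ 1ℤ)
    b″ = b′ ∘ (ℤ._+ 1ℤ)
    n  = b (+ suc (length ys))
    m  = b (+ suc (suc (length ys)))
    c  = b (+ suc (suc k))
    E  = eList (suc (suc k)) ys b′
    e₁ = eList (suc k) ys b″
    e₀ = eList k ys b″
    m≈ : m ≈ b′ (+ suc (length ys))
    m≈ = reflexive (≡.cong (b ∘ +_) (ℕₚ.+-comm 1 (suc (length ys))))
    e₁≈ : eList (suc k) ys b′ ≈ e₁ + (m - c) * e₀
    e₁≈ = trans (e-shift ys k b′) (+-congˡ (*-congʳ (+-cong (sym m≈)
      (-‿cong (reflexive (≡.cong (b ∘ +_) (ℕₚ.+-comm (suc k) 1)))))))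

  monicProduct : Carrier → List Carrier → Carrier
  monicProduct c = foldr (λ y r → (y - c) * r) 1#

  monicProduct-↭ : ∀ c {ys zs} → ys ↭ zs → monicProduct c ys ≈ monicProduct c zs
  monicProduct-↭ c ↭.refl         = refl
  monicProduct-↭ c (↭.prep y p)   = *-congˡ (monicProduct-↭ c p)
  monicProduct-↭ c (↭.swap x y p) = trans (*-congˡ (*-congˡ (monicProduct-↭ c p)))
    (solve 3 (λ x y z → x :* (y :* z) := y :* (x :* z)) refl _ _ _)
  monicProduct-↭ c (↭.trans p q)  = trans (monicProduct-↭ c p) (monicProduct-↭ c q)

  eList-overflow : ∀ {k} ys b → length ys < k → eList k ys b ≈ 0#
  eList-overflow []       b (s≤s l) = refl
  eList-overflow (y ∷ ys) b (s≤s l) = trans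
    (+-cong (eList-overflow ys b (ℕₚ.m≤n⇒m≤1+n l)) (*-congˡ (eList-overflow ys _ l)))
    (trans (+-identityˡ _) (zeroʳ _))

  -- Only the tuple n > ... > 1 contributes, and there each index i_j = n - j + 1 has subscript i_j
  -- + j - 1 = n, so all factors subtract the same b_n.
  eList-top : ∀ ys b → eList (length ys) ys b ≈ monicProduct (b (+ length ys)) ys
  eList-top []       b = refl
  eList-top (y ∷ ys) b = trans (+-cong (eList-overflow ys b ℕₚ.≤-refl)
    (*-congˡ (trans (eList-top ys _) (reflexive (≡.cong (λ m → monicProduct (b (+ m)) ys) (ℕₚ.+-comm (length ys) 1))))))
    (+-identityˡ _)

  -- The generating series of h and e.

  h-nodes e-nodes : (ℤ → Carrier) → Seq
  h-nodes b k = b (mirror (+ k))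
  e-nodes b k = b (+ k)

  hSeq eSeq : List Carrier → (ℤ → Carrier) → Seq
  hSeq ys b k = hList k ys b
  eSeq ys b k = eList k ys b

  hSeq-[]≗eSeq-[] : ∀ b → hSeq [] b ≗ eSeq [] b
  hSeq-[]≗eSeq-[] b zero    = refl
  hSeq-[]≗eSeq-[] b (suc k) = refl

  H E⁻ : List Carrier → (ℤ → Carrier) → Seq
  H  ys b = expand (h-nodes b) (hSeq ys b)
  E⁻ ys b = expand (e-nodes b) (alternate (eSeq ys b))

  module _ (y : Carrier) (ys : List Carrier) (b : ℤ → Carrier) where
    private
      n = b (+ suc (length ys))

    -- By `expand-linear` this says that a further variable `y` multiplies `H` by (1 - n t)/(1 - y
    -- t).
    h-recurrence : ∀ k → shift (h-nodes b) (hSeq (y ∷ ys) b) k - y * hList k (y ∷ ys) b ≈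
                         shift (h-nodes b) (hSeq ys b) k - n * hList k ys b
    h-recurrence zero    = solve 4 (λ c H n y → c :* con (+ 1) :+ (H :+ (y :- n) :* con (+ 1)) :- y :* con (+ 1)
                                  := c :* con (+ 1) :+ H :- n :* con (+ 1)) refl (h-nodes b 0) (hList 1 ys b) n y
    h-recurrence (suc k) = trans (+-congʳ (+-congˡ (+-congˡ (*-congˡ (h-step-shifted y ys k b)))))
      (solve 6 (λ c h g H n y → c :* (h :+ (y :- n) :* g) :+ (H :+ (y :- n) :* (h :+ (y :- c) :* g)) :- y :* (h :+ (y :- n) :* g)
                             := c :* h :+ H :- n :* h) refl (h-nodes b (suc k)) (hList (suc k) ys b) _ (hList (suc (suc k)) ys b) n y)

    -- The form without signs of `e⁻-recurrence`, by which a further variable multiplies `E⁻` by (1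
    -- - y t)/(1 - n t), the inverse of the factor for `H`.
    e-recurrence : ∀ k → eList (suc k) (y ∷ ys) b + (n - e-nodes b k) * eList k (y ∷ ys) b ≈
                         eList (suc k) ys b + (y - e-nodes b k) * eList k ys b
    e-recurrence zero    = solve 4 (λ E n c y → E :+ (y :- n) :* con (+ 1) :+ (n :- c) :* con (+ 1)
                                  := E :+ (y :- c) :* con (+ 1)) refl (eList 1 ys b) n (e-nodes b 0) y
    e-recurrence (suc k) = begin
      E + (y - n) * e₁ + (n - c) * (eList (suc k) ys b + (y - n) * e₀)
        ≈⟨ +-congˡ (*-congˡ (+-congʳ (e-shift ys k b))) ⟩
      E + (y - n) * e₁ + (n - c) * (e₁ + (n - c) * e₀ + (y - n) * e₀)
        ≈⟨ solve 6 (λ E n c y e₁ e₀ → E :+ (y :- n) :* e₁ :+ (n :- c) :* (e₁ :+ (n :- c) :* e₀ :+ (y :- n) :* e₀)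
                                    := E :+ (y :- c) :* (e₁ :+ (n :- c) :* e₀)) refl E n c y e₁ e₀ ⟩
      E + (y - c) * (e₁ + (n - c) * e₀)
        ≈⟨ +-congˡ (*-congˡ (e-shift ys k b)) ⟨
      E + (y - c) * eList (suc k) ys b ∎
      where
      c  = b (+ suc k)
      E  = eList (suc (suc k)) ys b
      e₁ = eList (suc k) ys (b ∘ (ℤ._+ 1ℤ))
      e₀ = eList k ys (b ∘ (ℤ._+ 1ℤ))

    e⁻-recurrence : ∀ k → shift (e-nodes b) (alternate (eSeq (y ∷ ys) b)) k - n * alternate (eSeq (y ∷ ys) b) k ≈
                          shift (e-nodes b) (alternate (eSeq ys b)) k - y * alternate (eSeq ys b) k
    e⁻-recurrence k = trans (rearrange (y ∷ ys) n) (trans (-‿cong (alternate-cong e-recurrence k)) (sym (rearrange ys y)))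
      where
      rearrange : ∀ zs z → shift (e-nodes b) (alternate (eSeq zs b)) k - z * alternate (eSeq zs b) k ≈
                  - alternate (λ l → eList (suc l) zs b + (z - e-nodes b l) * eList l zs b) k
      rearrange zs z = trans
        (solve 4 (λ c f g z → c :* f :+ :- g :- z :* f := :- (g :+ (z :- c) :* f)) refl _ _ _ _)
        (-‿cong (sym (trans (alternate-+ _ _ k) (+-congˡ (alternate-* (λ l → z - e-nodes b l) (eSeq zs b) k)))))

    H-linear : linear y (H (y ∷ ys) b) ≗ linear n (H ys b)
    H-linear = expand-linear (h-nodes b) y n h-recurrence refl

    E⁻-linear : linear n (E⁻ (y ∷ ys) b) ≗ linear y (E⁻ ys b)
    E⁻-linear = expand-linear (e-nodes b) n y e⁻-recurrence refl

  -- Each variable contributes mutually inverse factors to the two series, so the variables can be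
  -- removed one by one.
  H⊛E⁻ : ∀ ys b → H ys b ⊛ E⁻ ys b ≗ H [] b ⊛ E⁻ [] b
  H⊛E⁻ []       b m = refl
  H⊛E⁻ (y ∷ ys) b m = trans (⊛-transfer y _ (H-linear y ys b) (E⁻-linear y ys b) m) (H⊛E⁻ ys b m)

  -- Under t ↦ -t it is `E⁻` of the dual sequence that becomes an expansion over h-nodes, the left
  -- factor of `pairing`; hence this order of the factors.
  E⁻⊛H : ∀ ys b → E⁻ ys b ⊛ H ys b ≗ E⁻ [] b ⊛ H [] b
  E⁻⊛H []       b m = refl
  E⁻⊛H (y ∷ ys) b m = trans (⊛-transfer _ y (E⁻-linear y ys b) (H-linear y ys b) m) (E⁻⊛H ys b m)

-- Ring homomorphisms applied to series.

module _ (R S : CommutativeRing 0ℓ 0ℓ) where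
  private
    module R = CommutativeRing R
    module S = CommutativeRing S
    module SR = Series R
    module SS = Series S
  open RingMorphisms R.rawRing S.rawRing using (IsRingHomomorphism)

  module Map {φ : R.Carrier → S.Carrier} (φ-hom : IsRingHomomorphism φ) where
    open IsRingHomomorphism φ-hom

    expand-map : ∀ p f m → φ (SR.expand p f m) S.≈ SS.expand (φ ∘ p) (φ ∘ f) m
    expand-map p f zero    = S.refl
    expand-map p f (suc m) = S.trans (expand-map p (SR.shift p f) m)
      (SS.expand-cong (λ _ → S.refl) (λ k → S.trans (+-homo _ _) (S.+-congʳ (*-homo _ _))) m)

    alternate-map : ∀ f k → φ (SR.alternate f k) S.≈ SS.alternate (φ ∘ f) k
    alternate-map f zero    = S.refl
    alternate-map f (suc k) = S.trans (-‿homo _) (S.-‿cong (alternate-map (f ∘ suc) k))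

    ⊛-map : ∀ f g m → φ ((f SR.⊛ g) m) S.≈ ((φ ∘ f) SS.⊛ (φ ∘ g)) m
    ⊛-map f g zero    = *-homo _ _
    ⊛-map f g (suc m) = S.trans (+-homo _ _) (S.+-cong (*-homo _ _) (⊛-map (f ∘ suc) g m))

-- Substitution in polynomials.

substitute-≋ : {V W : Set} {f g : V → Poly W} → (∀ v → f v ≋ g v) → ∀ p → substitute f p ≋ substitute g p
substitute-≋ e (con c) = ≋-refl
substitute-≋ e (var v) = e v
substitute-≋ e (p ⊕ q) = ⊕-cong (substitute-≋ e p) (substitute-≋ e q)
substitute-≋ e (p ⊗ q) = ⊗-cong (substitute-≋ e p) (substitute-≋ e q)
substitute-≋ e (⊖ p)   = ⊖-cong (substitute-≋ e p)

substitute-∘ : {U V W : Set} (g : V → Poly W) (f : U → Poly V) → ∀ p →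
               substitute g (substitute f p) ≡ substitute (substitute g ∘ f) p
substitute-∘ g f (con c) = ≡.refl
substitute-∘ g f (var v) = ≡.refl
substitute-∘ g f (p ⊕ q) = ≡.cong₂ _⊕_ (substitute-∘ g f p) (substitute-∘ g f q)
substitute-∘ g f (p ⊗ q) = ≡.cong₂ _⊗_ (substitute-∘ g f p) (substitute-∘ g f q)
substitute-∘ g f (⊖ p)   = ≡.cong ⊖_ (substitute-∘ g f p)

≡⇒≋ : {V : Set} {p q : Poly V} → p ≡ q → p ≋ q
≡⇒≋ ≡.refl = ≋-refl

con-neg : {V : Set} (c : ℚ[a].Carrier) → con {V} (ℚ[a].- c) ≋ ⊖ con c
con-neg {V} c = inverseˡ-unique _ _ (≋-trans (≋-sym (con-+ _ _)) (con-cong (ℚ[a].-‿inverseˡ c)))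
  where open Algebra.Properties.Group (CommutativeRing.+-group (polynomialRing V)) using (inverseˡ-unique)

monomial : {V : Set} → List V → Poly V
monomial = foldr (λ v m → var v ⊗ m) (con ℚ[a].1#)

module _ {V W : Set} (f : V → Poly W) (f-degree : ∀ v → TotalDegree≤ 1 (f v)) where

  degree-substitute : ∀ {d p} → TotalDegree≤ d p → TotalDegree≤ d (substitute f p)
  degree-substitute {d} (ts , b , e) = deg-resp (≋-sym (substitute-cong f e)) (terms ts b)
    where
    monomials : ∀ m {d} → length m ≤ d → TotalDegree≤ d (substitute f (monomial m))
    monomials []      le       = deg-con _
    monomials (v ∷ m) (s≤s le) = deg-⊗ (f-degree v) (monomials m le)
    terms : ∀ ts → All (λ t → length (proj₂ t) ≤ d) ts → TotalDegree≤ d (substitute f (combination ts))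
    terms []             []       = deg-con _
    terms ((c , m) ∷ ts) (l ∷ ls) = deg-⊕ (deg-⊗ (deg-con c) (monomials m l)) (terms ts ls)

-- Divided differences and division by linear factors.

module _ {n : ℕ} where
  private
    module P = CommutativeRing (polynomialRing (Fin n))
  open IntegerSolver (polynomialRing (Fin n)) renaming (con to :con)
  open import Relation.Binary.Reasoning.Setoid P.setoid

  -- The result stays in the same n indeterminates, so that evaluations at different variables can
  -- be compared and multiplied.
  set : Fin n → ℚ[a].Carrier → Fin n → Poly (Fin n)
  set i c v with v ≟ i
  ... | yes _ = con c
  ... | no  _ = var v

  set-≡ : ∀ i c → set i c i ≡ con c
  set-≡ i c with i ≟ i
  ... | yes _   = ≡.refl
  ... | no  i≢i = contradiction ≡.refl i≢i

  set-≢ : ∀ {i v} c → v ≢ i → set i c v ≡ var v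
  set-≢ {i} {v} c v≢i with v ≟ i
  ... | yes v≡i = contradiction v≡i v≢i
  ... | no  _   = ≡.refl

  set-degree : ∀ i c v → TotalDegree≤ 1 (set i c v)
  set-degree i c v with v ≟ i
  ... | yes _ = deg-con c
  ... | no  _ = deg-var v

  linearFactor : ℚ[a].Carrier → Fin n → Poly (Fin n)
  linearFactor c i = var i P.- con c

  module _ (i : Fin n) (c : ℚ[a].Carrier) where
    private
      ev : Poly (Fin n) → Poly (Fin n)
      ev = substitute (set i c)

    -- The divided difference (p - p[x_i := c]) / (x_i - c).
    quotient : Poly (Fin n) → Poly (Fin n)
    quotient (con d) = con ℚ[a].0#
    quotient (var v) with v ≟ i
    ... | yes _ = con ℚ[a].1#
    ... | no  _ = con ℚ[a].0#
    quotient (p ⊕ q) = quotient p ⊕ quotient q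
    quotient (p ⊗ q) = quotient p ⊗ q ⊕ ev p ⊗ quotient q
    quotient (⊖ p)   = ⊖ quotient p

    quotient-spec : ∀ p → p ≋ ev p ⊕ linearFactor c i ⊗ quotient p
    quotient-spec (con d) = solve 2 (λ d x → d := d :+ x :* :con (+ 0)) ≋-refl (con d) (linearFactor c i)
    quotient-spec (var v) with v ≟ i
    ... | yes ≡.refl = solve 2 (λ x c → x := c :+ (x :- c) :* :con (+ 1)) ≋-refl (var v) (con c)
    ... | no  _      = solve 2 (λ x y → x := x :+ y :* :con (+ 0)) ≋-refl (var v) (linearFactor c i)
    quotient-spec (p ⊕ q) = ≋-trans (⊕-cong (quotient-spec p) (quotient-spec q))
      (solve 5 (λ p q x u v → p :+ x :* u :+ (q :+ x :* v) := p :+ q :+ x :* (u :+ v)) ≋-refl _ _ _ _ _)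
    quotient-spec (p ⊗ q) = ≋-trans (⊗-cong (quotient-spec p) ≋-refl)
      (≋-trans (P.distribʳ _ _ _) (≋-trans (⊕-cong (⊗-cong ≋-refl (quotient-spec q)) ≋-refl)
        (solve 6 (λ p q x u v r → p :* (q :+ x :* v) :+ x :* u :* r := p :* q :+ x :* (u :* r :+ p :* v)) ≋-refl _ _ _ _ _ _)))
    quotient-spec (⊖ p)   = ≋-trans (⊖-cong (quotient-spec p))
      (solve 3 (λ p x u → :- (p :+ x :* u) := :- p :+ x :* :- u) ≋-refl _ _ _)

    -- `quotient` is defined on formal expressions; checking every rule of `≋` makes it an operation
    -- on polynomials, which can then be applied to both sides of an equation.
    quotient-cong : ∀ {p q} → p ≋ q → quotient p ≋ quotient q
    quotient-cong ≋-refl             = ≋-refl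
    quotient-cong (≋-sym e)          = ≋-sym (quotient-cong e)
    quotient-cong (≋-trans d e)      = ≋-trans (quotient-cong d) (quotient-cong e)
    quotient-cong (⊕-cong d e)       = ⊕-cong (quotient-cong d) (quotient-cong e)
    quotient-cong (⊗-cong d e)       = ⊕-cong (⊗-cong (quotient-cong d) e)
                                              (⊗-cong (substitute-cong _ d) (quotient-cong e))
    quotient-cong (⊖-cong e)         = ⊖-cong (quotient-cong e)
    quotient-cong (⊕-assoc p q r)    = ⊕-assoc _ _ _
    quotient-cong (⊕-comm p q)       = ⊕-comm _ _
    quotient-cong (⊕-identity p)     = ⊕-identity _
    quotient-cong (⊕-inverse p)      = ⊕-inverse _
    quotient-cong (⊗-assoc p q r)    =
      solve 7 (λ p′ q r p₀ q′ q₀ r′ → (p′ :* q :+ p₀ :* q′) :* r :+ p₀ :* q₀ :* r′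
                                   := p′ :* (q :* r) :+ p₀ :* (q′ :* r :+ q₀ :* r′)) ≋-refl _ _ _ _ _ _ _
    -- The product rule is not symmetric in p and q; expanding the unevaluated factor by
    -- `quotient-spec` makes both sides agree.
    quotient-cong (⊗-comm p q)       = ≋-trans (⊕-cong (⊗-cong ≋-refl (quotient-spec q)) ≋-refl)
      (≋-trans (solve 5 (λ p′ q₀ x q′ p₀ → p′ :* (q₀ :+ x :* q′) :+ p₀ :* q′ := q′ :* (p₀ :+ x :* p′) :+ q₀ :* p′)
                 ≋-refl _ _ _ _ _)
        (⊕-cong (⊗-cong ≋-refl (≋-sym (quotient-spec p))) ≋-refl))
    quotient-cong (⊗-identity p)     = solve 2 (λ p u → :con (+ 0) :* p :+ :con (+ 1) :* u := u) ≋-refl _ _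
    quotient-cong (⊗-distrib p q r)  =
      solve 6 (λ p′ q r p₀ q′ r′ → p′ :* (q :+ r) :+ p₀ :* (q′ :+ r′) := p′ :* q :+ p₀ :* q′ :+ (p′ :* r :+ p₀ :* r′))
        ≋-refl _ _ _ _ _ _
    quotient-cong (con-cong e)       = ≋-refl
    quotient-cong (con-+ c d)        = ≋-sym (⊕-identity _)
    quotient-cong (con-* c d)        = solve 2 (λ c d → :con (+ 0) := :con (+ 0) :* d :+ c :* :con (+ 0)) ≋-refl (con c) (con d)

    set-linearFactor : ev (linearFactor c i) ≋ con ℚ[a].0#
    set-linearFactor = ≋-trans (⊕-cong (≡⇒≋ (set-≡ i c)) ≋-refl) (P.-‿inverseʳ (con c))

    quotient-linearFactor : quotient (linearFactor c i) ≋ con ℚ[a].1#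
    quotient-linearFactor with i ≟ i
    ... | yes _   = solve 0 (:con (+ 1) :- :con (+ 0) := :con (+ 1)) ≋-refl
    ... | no  i≢i = contradiction ≡.refl i≢i

    -- Applying `quotient` to the equation isolates `p`: in the product rule x_i - c has divided
    -- difference 1 and value 0 at x_i = c.
    linearFactor-cancel : ∀ {p} → linearFactor c i ⊗ p ≋ con ℚ[a].0# → p ≋ con ℚ[a].0#
    linearFactor-cancel {p} e = begin
      p
        ≈⟨ solve 2 (λ p u → p := :con (+ 1) :* p :+ :con (+ 0) :* u) ≋-refl p (quotient p) ⟩
      con ℚ[a].1# ⊗ p ⊕ con ℚ[a].0# ⊗ quotient p
        ≈⟨ ⊕-cong (⊗-cong quotient-linearFactor ≋-refl) (⊗-cong set-linearFactor ≋-refl) ⟨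
      quotient (linearFactor c i ⊗ p)
        ≈⟨ quotient-cong e ⟩
      con ℚ[a].0# ∎

    quotient-degree : ∀ {d p} → TotalDegree≤ (suc d) p → TotalDegree≤ d (quotient p)
    quotient-degree {d} (ts , b , e) = deg-resp (≋-sym (quotient-cong e)) (terms ts b)
      where
      variable-degree : ∀ v → TotalDegree≤ 0 (quotient (var v))
      variable-degree v with v ≟ i
      ... | yes _ = deg-con _
      ... | no  _ = deg-con _
      monomial-degree : ∀ m → TotalDegree≤ (length m) (monomial m)
      monomial-degree []      = deg-con _
      monomial-degree (v ∷ m) = deg-⊗ (deg-var v) (monomial-degree m)
      monomials : ∀ m {d} → length m ≤ suc d → TotalDegree≤ d (quotient (monomial m))
      monomials []           le       = deg-con _
      -- A single indeterminate is treated apart because d may be 0 here, while the general case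
      -- recurses at d - 1.
      monomials (v ∷ [])     (s≤s le) = deg-⊕
        (deg-mono z≤n (deg-⊗ (variable-degree v) (deg-con {d = 0} _)))
        (deg-resp (≋-sym (P.zeroʳ _)) (deg-con _))
      monomials (v ∷ m@(_ ∷ _)) {suc d} (s≤s le) = deg-⊕
        (deg-⊗ (variable-degree v) (deg-mono le (monomial-degree m)))
        (deg-⊗ (set-degree i c v) (monomials m le))
      terms : ∀ ts → All (λ t → length (proj₂ t) ≤ suc d) ts → TotalDegree≤ d (quotient (combination ts))
      terms []             []       = deg-con _
      terms ((k , m) ∷ ts) (l ∷ ls) = deg-⊕
        (deg-⊕ (deg-resp (≋-sym (P.zeroˡ _)) (deg-con _)) (deg-⊗ (deg-con k) (monomials m l)))
        (terms ts ls)

    quotient-constant : ∀ {p} → TotalDegree≤ 0 p → quotient p ≋ con ℚ[a].0#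
    quotient-constant (ts , b , e) = ≋-trans (quotient-cong e) (terms ts b)
      where
      terms : ∀ ts → All (λ t → length (proj₂ t) ≤ 0) ts → quotient (combination ts) ≋ con ℚ[a].0#
      terms []              []       = ≋-refl
      terms ((k , []) ∷ ts) (l ∷ ls) = ≋-trans
        (⊕-cong (solve 2 (λ x k → :con (+ 0) :* x :+ k :* :con (+ 0) := :con (+ 0)) ≋-refl _ _) (terms ts ls))
        (⊕-identity _)

  Vanishes : ℚ[a].Carrier → Poly (Fin n) → Fin n → Set
  Vanishes c p i = substitute (set i c) p ≋ con ℚ[a].0#

  vanishing-factor : ∀ c {p i} → Vanishes c p i → p ≋ linearFactor c i ⊗ quotient i c p
  vanishing-factor c {p} {i} e = ≋-trans (quotient-spec i c p) (≋-trans (⊕-cong e ≋-refl) (⊕-identity _))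

  -- Setting x_j = c in p = (x_i - c) q leaves x_i - c unchanged, as i and j differ, and this factor
  -- can be cancelled.
  vanishing-quotient : ∀ c {p i j} → i ≢ j → Vanishes c p i → Vanishes c p j → Vanishes c (quotient i c p) j
  vanishing-quotient c {p} {i} {j} i≢j e e′ = linearFactor-cancel i c (begin
    linearFactor c i ⊗ substitute (set j c) (quotient i c p)
      ≈⟨ ⊗-cong (⊕-cong (≡⇒≋ (set-≢ c i≢j)) ≋-refl) ≋-refl ⟨
    substitute (set j c) (linearFactor c i ⊗ quotient i c p)
      ≈⟨ substitute-cong (set j c) (vanishing-factor c {p} e) ⟨
    substitute (set j c) p
      ≈⟨ e′ ⟩
    con ℚ[a].0# ∎)

  factors : ℚ[a].Carrier → List (Fin n) → Poly (Fin n)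
  factors c is = Series.monicProduct (polynomialRing (Fin n)) (con c) (map var is)

  quotients : ℚ[a].Carrier → List (Fin n) → Poly (Fin n) → Poly (Fin n)
  quotients c []       p = p
  quotients c (i ∷ is) p = quotients c is (quotient i c p)

  quotients-spec : ∀ c {is p} → Unique is → All (Vanishes c p) is → p ≋ factors c is ⊗ quotients c is p
  quotients-spec c {[]}     {p} []       []       = ≋-sym (⊗-identity _)
  quotients-spec c {i ∷ is} {p} (u ∷ us) (e ∷ es) = begin
    p
      ≈⟨ vanishing-factor c {p} e ⟩
    linearFactor c i ⊗ quotient i c p
      ≈⟨ ⊗-cong ≋-refl (quotients-spec c us (All.zipWith (λ (i≢j , e′) → vanishing-quotient c {p} i≢j e e′) (u , es))) ⟩
    linearFactor c i ⊗ (factors c is ⊗ quotients c is (quotient i c p))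
      ≈⟨ ⊗-assoc _ _ _ ⟨
    factors c (i ∷ is) ⊗ quotients c (i ∷ is) p ∎

  factors-cancel : ∀ c is {p} → factors c is ⊗ p ≋ con ℚ[a].0# → p ≋ con ℚ[a].0#
  factors-cancel c []       e = ≋-trans (≋-sym (⊗-identity _)) e
  factors-cancel c (i ∷ is) e = factors-cancel c is (linearFactor-cancel i c (≋-trans (≋-sym (⊗-assoc _ _ _)) e))

  quotients-zero : ∀ c is {p} → p ≋ con ℚ[a].0# → quotients c is p ≋ con ℚ[a].0#
  quotients-zero c []       e = e
  quotients-zero c (i ∷ is) e = quotients-zero c is (quotient-cong i c e)

  quotients-degree : ∀ c is {d p} → TotalDegree≤ (length is ℕ.+ d) p → TotalDegree≤ d (quotients c is p)
  quotients-degree c []       b = b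
  quotients-degree c (i ∷ is) b = quotients-degree c is (quotient-degree i c b)

  -- Each division lowers the degree bound, and the divided difference of a constant is 0.
  quotients-excess : ∀ c is {d p} → d < length is → TotalDegree≤ d p → quotients c is p ≋ con ℚ[a].0#
  quotients-excess c (i ∷ is) {zero}  le       b = quotients-zero c is (quotient-constant i c b)
  quotients-excess c (i ∷ is) {suc d} (s≤s le) b = quotients-excess c is le (quotient-degree i c b)

-- Setting the last variable of a symmetric polynomial.

punchIn-elim : ∀ {n} (i : Fin (suc n)) (Q : Fin (suc n) → Set) → Q i → (∀ j → Q (punchIn i j)) → ∀ j → Q j
punchIn-elim i Q q qs j with i ≟ j
... | yes ≡.refl = q
... | no  i≢j    = ≡.subst Q (punchIn-punchOut i≢j) (qs (punchOut i≢j))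

insert-self : ∀ {n} (i j : Fin (suc n)) (σ : Permutation′ n) → Perm.insert i j σ ⟨$⟩ʳ i ≡ j
insert-self i j σ with i ≟ i
... | yes _   = ≡.refl
... | no  i≢i = contradiction ≡.refl i≢i

setLast : ∀ n → ℚ[a].Carrier → Fin (suc n) → Poly (Fin n)
setLast n c = insertAt var (fromℕ n) (con c)

setLast-degree : ∀ n c v → TotalDegree≤ 1 (setLast n c v)
setLast-degree n c = punchIn-elim (fromℕ n) (TotalDegree≤ 1 ∘ setLast n c)
  (≡.subst (TotalDegree≤ 1) (≡.sym (insertAt-lookup var (fromℕ n) (con c))) (deg-con c))
  (λ j → ≡.subst (TotalDegree≤ 1) (≡.sym (insertAt-punchIn var (fromℕ n) (con c) j)) (deg-var j))

substitute-substitute : {U V W X : Set} {g : V → Poly W} {f : U → Poly V} {g′ : X → Poly W} {f′ : U → Poly X} →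
  (∀ v → substitute g (f v) ≡ substitute g′ (f′ v)) →
  ∀ p → substitute g (substitute f p) ≋ substitute g′ (substitute f′ p)
substitute-substitute {g = g} {f} {g′} {f′} e p = ≋-trans (≡⇒≋ (substitute-∘ g f p))
  (≋-trans (substitute-≋ (≡⇒≋ ∘ e) p) (≡⇒≋ (≡.sym (substitute-∘ g′ f′ p))))

module _ {n : ℕ} {p : Poly (Fin (suc n))} (p-symmetric : Symmetric p) (c : ℚ[a].Carrier) where

  setLast-symmetric : Symmetric (substitute (setLast n c) p)
  setLast-symmetric σ = ≋-trans
    (substitute-substitute {g = var ∘ (σ ⟨$⟩ʳ_)} {setLast n c} {setLast n c} {var ∘ (σ⁺ ⟨$⟩ʳ_)}
      (punchIn-elim last _ at-last elsewhere) p)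
    (substitute-cong (setLast n c) (p-symmetric σ⁺))
    where
    last = fromℕ n
    -- The extension of `σ` that fixes the last index commutes with setting the last variable.
    σ⁺ = Perm.insert last last σ
    at-last : substitute (var ∘ (σ ⟨$⟩ʳ_)) (setLast n c last) ≡ setLast n c (σ⁺ ⟨$⟩ʳ last)
    at-last = ≡.trans (≡.cong (substitute _) (insertAt-lookup var last (con c)))
      (≡.sym (≡.trans (≡.cong (setLast n c) (insert-self last last σ)) (insertAt-lookup var last (con c))))
    elsewhere : ∀ j → substitute (var ∘ (σ ⟨$⟩ʳ_)) (setLast n c (punchIn last j)) ≡ setLast n c (σ⁺ ⟨$⟩ʳ punchIn last j)
    elsewhere j = ≡.trans (≡.cong (substitute _) (insertAt-punchIn var last (con c) j))
      (≡.sym (≡.trans (≡.cong (setLast n c) (insert-punchIn last last σ j)) (insertAt-punchIn var last (con c) _)))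

  -- The permutation `τ` moves the last index to `i` and keeps the order of the others. Hence
  -- setting x_i = c after `τ` is setting the last variable and then renaming along `punchIn i`.
  vanishes-everywhere : substitute (setLast n c) p ≋ con ℚ[a].0# → ∀ i → Vanishes c p i
  vanishes-everywhere e i = ≋-trans (substitute-cong (set i c) (≋-sym (p-symmetric τ)))
    (≋-trans (substitute-substitute {g = set i c} {var ∘ (τ ⟨$⟩ʳ_)} {var ∘ punchIn i} {setLast n c}
                (punchIn-elim last _ at-last elsewhere) p)
      (substitute-cong (var ∘ punchIn i) e))
    where
    last = fromℕ n
    τ = Perm.insert last i Perm.id
    at-last : set i c (τ ⟨$⟩ʳ last) ≡ substitute (var ∘ punchIn i) (setLast n c last)
    at-last = ≡.trans (≡.cong (set i c) (insert-self last i Perm.id))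
      (≡.trans (set-≡ i c) (≡.sym (≡.cong (substitute _) (insertAt-lookup var last (con c)))))
    elsewhere : ∀ j → set i c (τ ⟨$⟩ʳ punchIn last j) ≡ substitute (var ∘ punchIn i) (setLast n c (punchIn last j))
    elsewhere j = ≡.trans (≡.cong (set i c) (insert-punchIn last i Perm.id j))
      (≡.trans (set-≢ c (punchInᵢ≢i i j)) (≡.sym (≡.cong (substitute _) (insertAt-punchIn var last (con c) j))))

-- Division by the product of all x_i - c.

module _ {n : ℕ} where
  private
    module P = CommutativeRing (polynomialRing (Fin n))
  open Series (polynomialRing (Fin n)) using (monicProduct; monicProduct-↭; eList-top)
  open Sums n using (eList; eSum≈eList; eList-↭; list-↭; tabulate-↭)
  open import Algebra.Properties.Group P.+-group using (x∙y⁻¹≈ε⇒x≈y; x≈y⇒x∙y⁻¹≈ε)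
  open import Relation.Binary.Reasoning.Setoid P.setoid
  open import Algebra.Properties.Ring P.ring using (x[y-z]≈xy-xz)

  allFactors : ℚ[a].Carrier → Poly (Fin n)
  allFactors c = factors c (allFin n)

  allQuotients : ℚ[a].Carrier → Poly (Fin n) → Poly (Fin n)
  allQuotients c = quotients c (allFin n)

  map-var : _≡_ {A = List (Poly (Fin n))} (map var (allFin n)) (tabulate var)
  map-var = map-tabulate id var

  substitute-monicProduct : ∀ (f : Fin n → Poly (Fin n)) c ys →
    substitute f (monicProduct (con c) ys) ≡ monicProduct (con c) (map (substitute f) ys)
  substitute-monicProduct f c []       = ≡.refl
  substitute-monicProduct f c (y ∷ ys) = ≡.cong ((substitute f y ⊕ ⊖ con c) ⊗_) (substitute-monicProduct f c ys)

  allFactors-symmetric : ∀ c → Symmetric (allFactors c)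
  allFactors-symmetric c σ = begin
    substitute f (monicProduct (con c) (map var (allFin n)))    ≡⟨ substitute-monicProduct f c (map var (allFin n)) ⟩
    monicProduct (con c) (map (substitute f) (map var (allFin n)))
      ≡⟨ ≡.cong (λ ys → monicProduct (con c) (map (substitute f) ys)) map-var ⟩
    monicProduct (con c) (map (substitute f) (tabulate var))    ≡⟨ ≡.cong (monicProduct (con c)) (map-tabulate var (substitute f)) ⟩
    monicProduct (con c) (tabulate f)                           ≈⟨ monicProduct-↭ (con c) (tabulate-↭ var σ) ⟩
    monicProduct (con c) (tabulate var)                         ≡⟨ ≡.cong (monicProduct (con c)) map-var ⟨
    allFactors c                                                ∎
    where
    f : Fin n → Poly (Fin n)
    f i = var (σ ⟨$⟩ʳ i)

  -- This identifies the divisor at c = b_n with a generator. The sum lists the variables from last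
  -- to first, and `eList-↭` reorders them.
  e-top : ∀ b → component (e b n) n ≋ allFactors (b (+ n))
  e-top b = begin
    component (e b n) n                            ≈⟨ eSum≈eList n var (con ∘ b) ⟩
    eList n (applyDownFrom (Sums.ext n var) n) _   ≈⟨ eList-↭ (list-↭ var) n (con ∘ b) ⟩
    eList n (tabulate var) (con ∘ b)
      ≈⟨ ≡.subst (λ m → eList m (tabulate var) (con ∘ b) ≋ monicProduct (con (b (+ m))) (tabulate var))
           (length-tabulate var) (eList-top (tabulate var) (con ∘ b)) ⟩
    monicProduct (con (b (+ n))) (tabulate var)    ≡⟨ ≡.cong (monicProduct _) map-var ⟨
    allFactors (b (+ n))                           ∎

  module _ (c : ℚ[a].Carrier) {p : Poly (Fin n)} (vanishes : ∀ i → Vanishes c p i) where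

    allQuotients-spec : p ≋ allFactors c ⊗ allQuotients c p
    allQuotients-spec = quotients-spec c (allFin⁺ n) (tabulate⁺ vanishes)

    -- Both `p` and the divisor are symmetric, so the divisor times the difference of the permuted
    -- and the original quotient is 0, and the divisor cancels.
    allQuotients-symmetric : Symmetric p → Symmetric (allQuotients c p)
    allQuotients-symmetric p-symmetric σ = x∙y⁻¹≈ε⇒x≈y _ _ (factors-cancel c (allFin n) (begin
      allFactors c ⊗ (σq P.- q)                ≈⟨ x[y-z]≈xy-xz _ _ _ ⟩
      allFactors c ⊗ σq P.- allFactors c ⊗ q   ≈⟨ x≈y⇒x∙y⁻¹≈ε (begin
        allFactors c ⊗ σq                           ≈⟨ ⊗-cong (allFactors-symmetric c σ) ≋-refl ⟨
        substitute f (allFactors c ⊗ q)             ≈⟨ substitute-cong f allQuotients-spec ⟨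
        substitute f p                              ≈⟨ p-symmetric σ ⟩
        p                                           ≈⟨ allQuotients-spec ⟩
        allFactors c ⊗ q                            ∎) ⟩
      con ℚ[a].0#                              ∎))
      where
      f : Fin n → Poly (Fin n)
      f i = var (σ ⟨$⟩ʳ i)
      q σq : Poly (Fin n)
      q  = allQuotients c p
      σq = substitute f q

    -- Dividing by n linear factors exhausts a degree below n, so the quotient is 0.
    vanishing-low-degree : ∀ {d} → d < n → TotalDegree≤ d p → p ≋ con ℚ[a].0#
    vanishing-low-degree d<n b = ≋-trans allQuotients-spec (≋-trans
      (⊗-cong ≋-refl (quotients-excess c (allFin n) (≡.subst (_ <_) (≡.sym (length-tabulate {n = n} id)) d<n) b)) (P.zeroʳ _))

  allQuotients-degree : ∀ c {d p} → TotalDegree≤ (n ℕ.+ d) p → TotalDegree≤ d (allQuotients c p)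
  allQuotients-degree c {d} {p} b =
    quotients-degree c (allFin n) (≡.subst (λ m → TotalDegree≤ (m ℕ.+ d) p) (≡.sym (length-tabulate {n = n} id)) b)

-- Generation of Λ(x‖b) by the e_k.

constant-polynomial : (p : Poly (Fin 0)) → ∃ λ c → p ≋ con c
constant-polynomial (con c) = c , ≋-refl
constant-polynomial (p ⊕ q) with constant-polynomial p | constant-polynomial q
... | c , d | c′ , d′ = c ℚ[a].+ c′ , ≋-trans (⊕-cong d d′) (≋-sym (con-+ c c′))
constant-polynomial (p ⊗ q) with constant-polynomial p | constant-polynomial q
... | c , d | c′ , d′ = c ℚ[a].* c′ , ≋-trans (⊗-cong d d′) (≋-sym (con-* c c′))
constant-polynomial (⊖ p) with constant-polynomial p
... | c , d = ℚ[a].- c , ≋-trans (⊖-cong d) (≋-sym (con-neg c))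

-- Polynomials in the e_k as syntax, so that identities of ring homomorphisms follow by induction. A
-- generator carries the proof of 1 ≤ k that `e↦h` demands.
data Expression : Set where
  scalar      : ℚ[a].Carrier → Expression
  generator   : ∀ k → 1 ≤ k → Expression
  sum product : Expression → Expression → Expression

module _ (b : ℤ → ℚ[a].Carrier) where
  private
    module L = CommutativeRing (ΛRing b)

  ⟦_⟧ : Expression → Λ b
  ⟦ scalar c ⟧      = c · L.1#
  ⟦ generator k _ ⟧ = e b k
  ⟦ sum s t ⟧       = ⟦ s ⟧ L.+ ⟦ t ⟧
  ⟦ product s t ⟧   = ⟦ s ⟧ L.* ⟦ t ⟧

  -- The polynomial is matched in the n-th component only, but the degree is bounded in every
  -- component; `determined` needs this bound.
  Represents : ∀ n → ℕ → Poly (Fin n) → Expression → Set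
  Represents n d p t = (∀ m → TotalDegree≤ d (component ⟦ t ⟧ m)) × component ⟦ t ⟧ n ≋ p

  represent-constant : ∀ {d} (p : Poly (Fin 0)) → ∃ (Represents 0 d p)
  represent-constant p = scalar c , (λ m → deg-⊗ (deg-con {d = 0} c) (deg-con _)) ,
    ≋-trans (≋-trans (⊗-comm _ _) (⊗-identity _)) (≋-sym p≋c)
    where
    c = proj₁ (constant-polynomial p)
    p≋c = proj₂ (constant-polynomial p)

  module _ {n d : ℕ} {p : Poly (Fin (suc n))} (p-symmetric : Symmetric p) (p-degree : TotalDegree≤ d p)
           (t : Expression) (t-represents : Represents n d (substitute (setLast n (b (+ suc n))) p) t) where
    private
      module P = CommutativeRing (polynomialRing (Fin (suc n)))
      c = b (+ suc n)
      q = component ⟦ t ⟧ (suc n)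
    open import Algebra.Properties.Group P.+-group using (x∙y⁻¹≈ε⇒x≈y)
    open import Relation.Binary.Reasoning.Setoid P.setoid
    open IntegerSolver (polynomialRing (Fin (suc n))) using (solve; _:=_; _:+_; _:-_)

    remainder : Poly (Fin (suc n))
    remainder = p P.- q

    remainder-symmetric : Symmetric remainder
    remainder-symmetric σ = ⊕-cong (p-symmetric σ) (⊖-cong (symmetric ⟦ t ⟧ (suc n) σ))

    remainder-degree : TotalDegree≤ d remainder
    remainder-degree = deg-⊕ p-degree (deg-⊖ (proj₁ t-represents (suc n)))

    -- By stability, setting the last variable to b_(n+1) turns `q` into the n-th component of
    -- `⟦ t ⟧`, which `t` was chosen to match.
    remainder-vanishes : ∀ i → Vanishes c remainder i
    remainder-vanishes = vanishes-everywhere remainder-symmetric c (≋-trans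
      (⊕-cong ≋-refl (⊖-cong (≋-trans (stable ⟦ t ⟧ n) (proj₂ t-represents))))
      (CommutativeRing.-‿inverseʳ (polynomialRing (Fin n)) _))

    represent-low : d < suc n → ∃ (Represents (suc n) d p)
    represent-low d<n = t , proj₁ t-represents ,
      ≋-sym (x∙y⁻¹≈ε⇒x≈y _ _ (vanishing-low-degree c remainder-vanishes d<n remainder-degree))

    -- The correction to `t` is e_(n+1) times the quotient of the remainder; its degree is at most n
    -- + 1 + d′ = d in every component.
    represent-high : ∀ {d′} → suc n ℕ.+ d′ ≡ d → ∃ (Represents (suc n) d′ (allQuotients c remainder)) →
                     ∃ (Represents (suc n) d p)
    represent-high ≡.refl (s , s-degree , s≋) =
      sum t (product (generator (suc n) (s≤s z≤n)) s) ,
      (λ m → deg-⊕ (proj₁ t-represents m) (deg-⊗ (proj₂ (bounded (e b (suc n))) m) (s-degree m))) ,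
      (begin
        q ⊕ component (e b (suc n)) (suc n) ⊗ component ⟦ s ⟧ (suc n)
          ≈⟨ ⊕-cong ≋-refl (⊗-cong (e-top b) s≋) ⟩
        q ⊕ allFactors c ⊗ allQuotients c remainder
          ≈⟨ ⊕-cong ≋-refl (allQuotients-spec c remainder-vanishes) ⟨
        q ⊕ (p P.- q)
          ≈⟨ solve 2 (λ q p → q :+ (p :- q) := p) ≋-refl q p ⟩
        p ∎)

  Representable : ℕ → ℕ → Set
  Representable n d = {p : Poly (Fin n)} → Symmetric p → TotalDegree≤ d p → ∃ (Represents n d p)

  -- The restriction to n variables keeps d, while the quotient keeps n + 1 variables and lowers d
  -- by n + 1. Hence an inner well-founded induction on d inside the induction on n.
  represent-suc : ∀ n → (∀ d → Representable n d) → ∀ d → Acc _<_ d → Representable (suc n) d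
  represent-suc n ih d (acc rs) {p} p-symmetric p-degree = by-size (suc n ℕₚ.≤? d)
    where
    c = b (+ suc n)
    restricted : ∃ (Represents n d (substitute (setLast n c) p))
    restricted = ih d (setLast-symmetric p-symmetric c) (degree-substitute (setLast n c) (setLast-degree n c) p-degree)
    t = proj₁ restricted
    t-represents = proj₂ restricted
    by-size : Dec (suc n ≤ d) → ∃ (Represents (suc n) d p)
    by-size (no  n≰d) = represent-low p-symmetric p-degree t t-represents (ℕₚ.≰⇒> n≰d)
    by-size (yes n≤d) = represent-high p-symmetric p-degree t t-represents d≡
      (represent-suc n ih (d ℕ.∸ suc n) (rs (ℕₚ.∸-monoʳ-< {d} {suc n} {0} (s≤s z≤n) n≤d))
        (allQuotients-symmetric c (remainder-vanishes p-symmetric p-degree t t-represents)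
          (remainder-symmetric p-symmetric p-degree t t-represents))
        (allQuotients-degree c (≡.subst (λ m → TotalDegree≤ m (remainder p-symmetric p-degree t t-represents))
          (≡.sym d≡) (remainder-degree p-symmetric p-degree t t-represents))))
      where
      d≡ : suc n ℕ.+ (d ℕ.∸ suc n) ≡ d
      d≡ = ℕₚ.m+[n∸m]≡n n≤d

  represent : ∀ n d → Representable n d
  represent zero    d {p} _ _ = represent-constant p
  represent (suc n) d         = represent-suc n (represent n) d (<-wellFounded d)

  determined : ∀ (D : Λ b) d → (∀ m → TotalDegree≤ d (component D m)) →
               -- The component at d + n lies above both d and n: it is reached from d by vanishing
               -- and then restricted to n by stability, so n and d are never compared.
               component D d ≋ con ℚ[a].0# → ∀ n → component D n ≋ con ℚ[a].0#
  determined D d D-degree D≋0 n = below d n (≡.subst (λ m → component D m ≋ con ℚ[a].0#) (ℕₚ.+-comm n d) (above n))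
    where
    above : ∀ k → component D (k ℕ.+ d) ≋ con ℚ[a].0#
    above zero    = D≋0
    above (suc k) = vanishing-low-degree (b (+ suc (k ℕ.+ d)))
      (vanishes-everywhere (symmetric D (suc (k ℕ.+ d))) _ (≋-trans (stable D (k ℕ.+ d)) (above k)))
      (s≤s (ℕₚ.m≤n+m d k)) (D-degree (suc (k ℕ.+ d)))
    below : ∀ k m → component D (k ℕ.+ m) ≋ con ℚ[a].0# → component D m ≋ con ℚ[a].0#
    below zero    m z = z
    below (suc k) m z = below k m (≋-trans (≋-sym (stable D (k ℕ.+ m))) (substitute-cong _ z))

  -- With d a degree bound of `P`, representing its d-th component suffices: `determined` applies to
  -- the difference of `P` and `⟦ t ⟧`.
  generation : (P : Λ b) → ∃ λ t → P ≈Λ ⟦ t ⟧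
  generation P = t , λ n → x∙y⁻¹≈ε⇒x≈y n (component P n) (component ⟦ t ⟧ n) (determined (P L.- ⟦ t ⟧) d
    (λ m → deg-⊕ (proj₂ (bounded P) m) (deg-⊖ (proj₁ t-represents m)))
    (≋-trans (⊕-cong (≋-sym (proj₂ t-represents)) ≋-refl) (CommutativeRing.-‿inverseʳ (polynomialRing (Fin d)) _)) n)
    where
    d = proj₁ (bounded P)
    representation = represent d d (symmetric P d) (proj₂ (bounded P) d)
    t = proj₁ representation
    t-represents = proj₂ representation
    module G n = Algebra.Properties.Group (CommutativeRing.+-group (polynomialRing (Fin n)))
    open G using (x∙y⁻¹≈ε⇒x≈y)

-- The relation between h and e inside Λ(x‖b).

module _ (b : ℤ → ℚ[a].Carrier) where
  private
    module L = CommutativeRing (ΛRing b)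
    module SL = Series (ΛRing b)

  component-isRingHomomorphism : ∀ n →
    RingMorphisms.IsRingHomomorphism L.rawRing (CommutativeRing.rawRing (polynomialRing (Fin n))) (λ P → component P n)
  component-isRingHomomorphism n = record
    { isSemiringHomomorphism = record
      { isNearSemiringHomomorphism = record
        { +-isMonoidHomomorphism = record
          { isMagmaHomomorphism = record
            { isRelHomomorphism = record { cong = λ e → e n }
            ; homo = λ _ _ → ≋-refl
            }
          ; ε-homo = ≋-refl
          }
        ; *-homo = λ _ _ → ≋-refl
        }
      ; 1#-homo = ≋-refl
      }
    ; -‿homo = λ _ → ≋-refl
    }

  ι : ℚ[a].Carrier → Λ b
  ι x = x · L.1#

  -- The common values of h_k and e_k in no variables, placed in Λ(x‖b) so that ω can be applied to
  -- the constant side of the relation.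
  unit : ℕ → Λ b
  unit zero    = L.1#
  unit (suc k) = L.0#

  -- (Σ_k f_k U_k) (Σ_k (-1)^k g_k V_k), with U_k and V_k as at the top
  pairing : (f g : ℕ → Λ b) → ℕ → Λ b
  pairing f g = SL.expand (ι ∘ b ∘ mirror ∘ +_) f SL.⊛ SL.expand (ι ∘ b ∘ +_) (SL.alternate g)

  module Image {n : ℕ} {φ : Λ b → Poly (Fin n)}
    (φ-hom : RingMorphisms.IsRingHomomorphism L.rawRing (CommutativeRing.rawRing (polynomialRing (Fin n))) φ)
    (φ-ι : ∀ x → φ (ι x) ≋ con x)
    where
    open Series (polynomialRing (Fin n))
    open RingMorphisms.IsRingHomomorphism φ-hom using (1#-homo; 0#-homo)
    open Map (ΛRing b) (polynomialRing (Fin n)) φ-hom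

    -- It is used both for taking the n-th component and for doing so after ω, hence the general
    -- homomorphism fixing scalars.
    pairing-image : ∀ {f g f′ g′} → φ ∘ f ≗ f′ → φ ∘ g ≗ g′ → ∀ m →
      φ (pairing f g m) ≋ (expand (h-nodes (con ∘ b)) f′ ⊛ expand (e-nodes (con ∘ b)) (alternate g′)) m
    pairing-image {f} {g} d e m = ≋-trans
      (⊛-map (SL.expand (ι ∘ b ∘ mirror ∘ +_) f) (SL.expand (ι ∘ b ∘ +_) (SL.alternate g)) m)
      (⊛-cong
        (λ k → ≋-trans (expand-map (ι ∘ b ∘ mirror ∘ +_) f k) (expand-cong (λ l → φ-ι _) d k))
        (λ k → ≋-trans (expand-map (ι ∘ b ∘ +_) (SL.alternate g) k)
          (expand-cong (λ l → φ-ι _) (λ l → ≋-trans (alternate-map g l) (alternate-cong e l)) k)) m)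

    unit-image : ∀ d → φ ∘ unit ≗ hSeq [] d
    unit-image d zero    = 1#-homo
    unit-image d (suc k) = 0#-homo

  pairing-he : ∀ m → pairing (h b) (e b) m ≈Λ pairing unit unit m
  pairing-he m n = ≋-trans (pairing-image (λ k → hSum≈hList k var (con ∘ b)) (λ k → eSum≈eList k var (con ∘ b)) m)
    (≋-trans (H⊛E⁻ (applyDownFrom (ext var) n) (con ∘ b) m)
      (≋-sym (pairing-image (unit-image _) (λ k → ≋-trans (unit-image _ k) (hSeq-[]≗eSeq-[] (con ∘ b) k)) m)))
    where
    open Series (polynomialRing (Fin n))
    open Sums n using (hSum≈hList; eSum≈eList; ext)
    open Image (component-isRingHomomorphism n) (λ x → ≋-trans (⊗-comm _ _) (⊗-identity _))

-- The image of h_k under ω.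

module _ {b c : ℤ → ℚ[a].Carrier} (dual : ∀ i → c i ℚ[a].≈ ℚ[a].- b (mirror i))
         {ω : Λ b → Λ c} (isOmega : IsOmega b c ω) where
  private
    module B = CommutativeRing (ΛRing b)
    module C = CommutativeRing (ΛRing c)
  open IsOmega isOmega
  open RingMorphisms.IsRingHomomorphism isRingHomomorphism

  module _ (n : ℕ) where
    private
      module P = CommutativeRing (polynomialRing (Fin n))
    open Series (polynomialRing (Fin n)) hiding (linear)
    open Sums n using (hSum≈hList; eSum≈eList; ext)
    open Algebra.Properties.Ring P.ring using (-‿involutive)
    open import Relation.Binary.Reasoning.Setoid P.setoid

    private
      φ : Λ b → Poly (Fin n)
      φ P = component (ω P) n

      φ-ι : ∀ x → φ (ι b x) ≋ con x
      φ-ι x = ≋-trans (linear x B.1# n) (≋-trans (⊗-cong ≋-refl (1#-homo n)) (≋-trans (⊗-comm _ _) (⊗-identity _)))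

      open Image b (Composition.isRingHomomorphism {R₁ = B.rawRing} {C.rawRing} {P.rawRing} ≋-trans
        isRingHomomorphism (component-isRingHomomorphism c n)) φ-ι

      b̂ ĉ : ℤ → Poly (Fin n)
      b̂ = con ∘ b
      ĉ = con ∘ c

      ys : List (Poly (Fin n))
      ys = applyDownFrom (ext var) n

      -- Negation exchanges the two kinds of nodes: -c_(1-k) = b_k and -c_k = b_(1-k). The separate
      -- index `j` lets the first case be supplied by `mirror-involutive`.
      -ĉ≋b̂ : ∀ i j → mirror i ≡ j → ⊖ ĉ i ≋ b̂ j
      -ĉ≋b̂ i j ≡.refl = ≋-trans (⊖-cong (con-cong (dual i))) (≋-trans (⊖-cong (con-neg _)) (-‿involutive _))

      φ-e : φ ∘ e b ≗ hSeq ys ĉ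
      -- `e↦h` starts at k = 1; for k = 0 the sum has the empty tuple as its only term and equals 1,
      -- which ω preserves.
      φ-e zero    = ≋-trans (⟦⟧-cong {e b 0} {B.1#} (λ m → ≋-trans (⊕-comm _ _) (⊕-identity _)) n) (1#-homo n)
      φ-e (suc k) = ≋-trans (e↦h (suc k) (s≤s z≤n) n) (hSum≈hList (suc k) var ĉ)

      alternate-H : ∀ zs → alternate (H zs ĉ) ≗ expand (e-nodes b̂) (alternate (hSeq zs ĉ))
      alternate-H zs m = ≋-trans (≋-sym (expand-alternate (h-nodes ĉ) (hSeq zs ĉ) m))
        (expand-cong (λ k → -ĉ≋b̂ _ _ (mirror-involutive (+ k))) (λ _ → ≋-refl) m)

      alternate-E⁻ : ∀ zs → alternate (E⁻ zs ĉ) ≗ expand (h-nodes b̂) (eSeq zs ĉ)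
      alternate-E⁻ zs m = ≋-trans (≋-sym (expand-alternate (e-nodes ĉ) (alternate (eSeq zs ĉ)) m))
        (expand-cong (λ k → -ĉ≋b̂ _ _ ≡.refl) (alternate-involutive (eSeq zs ĉ)) m)

      -- Under t ↦ -t the product for c takes the shape of the pairing for b, with e and h of c
      -- exchanged.
      twisted : ∀ zs → alternate (E⁻ zs ĉ ⊛ H zs ĉ) ≗ expand (h-nodes b̂) (eSeq zs ĉ) ⊛ expand (e-nodes b̂) (alternate (hSeq zs ĉ))
      twisted zs m = ≋-trans (≋-sym (⊛-alternate (E⁻ zs ĉ) (H zs ĉ) m)) (⊛-cong (alternate-E⁻ zs) (alternate-H zs) m)

    -- Both sequences, expanded over the h-nodes of b, have the same product with Σ (-1)^k h_k(x‖c)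
    -- V_k. This series has constant term 1 and cancels, and the expansion is injective.
    ω-h-component : ∀ k → φ (h b k) ≋ eSeq ys ĉ k
    ω-h-component = expand-injective (h-nodes b̂) (⊛-cancelʳ (expand (e-nodes b̂) (alternate (hSeq ys ĉ))) ≋-refl (λ m → begin
      (expand (h-nodes b̂) (φ ∘ h b) ⊛ expand (e-nodes b̂) (alternate (hSeq ys ĉ))) m
        ≈⟨ pairing-image (λ _ → ≋-refl) φ-e m ⟨
      φ (pairing b (h b) (e b) m)
        ≈⟨ ⟦⟧-cong {pairing b (h b) (e b) m} {pairing b (unit b) (unit b) m} (pairing-he b m) n ⟩
      -- The images of `unit` are also e_k and h_k of c in no variables; from here on the relation
      -- is the one for c.
      φ (pairing b (unit b) (unit b) m)
        ≈⟨ pairing-image (λ k → ≋-trans (unit-image ĉ k) (hSeq-[]≗eSeq-[] ĉ k)) (unit-image ĉ) m ⟩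
      (expand (h-nodes b̂) (eSeq [] ĉ) ⊛ expand (e-nodes b̂) (alternate (hSeq [] ĉ))) m
        ≈⟨ twisted [] m ⟨
      alternate (E⁻ [] ĉ ⊛ H [] ĉ) m
        ≈⟨ alternate-cong (E⁻⊛H ys ĉ) m ⟨
      alternate (E⁻ ys ĉ ⊛ H ys ĉ) m
        ≈⟨ twisted ys m ⟩
      (expand (h-nodes b̂) (eSeq ys ĉ) ⊛ expand (e-nodes b̂) (alternate (hSeq ys ĉ))) m ∎))

  ω-h : ∀ k → ω (h b k) ≈Λ e c k
  ω-h k n = ≋-trans (ω-h-component n k) (≋-sym (Sums.eSum≈eList n k var (con ∘ c)))

  ω-hList : ∀ ks → ω (foldr B._*_ B.1# (map (h b) ks)) ≈Λ foldr C._*_ C.1# (map (e c) ks)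
  ω-hList []       = 1#-homo
  ω-hList (k ∷ ks) n = ≋-trans (*-homo (h b k) (foldr B._*_ B.1# (map (h b) ks)) n) (⊗-cong (ω-h k n) (ω-hList ks n))

-- Involutivity.

module _ {b c : ℤ → ℚ[a].Carrier} (dual : ∀ i → b i ℚ[a].≈ ℚ[a].- c (mirror i))
         {ω : Λ b → Λ c} (isOmega : IsOmega b c ω) {ω′ : Λ c → Λ b} (isOmega′ : IsOmega c b ω′) where
  private
    module B = CommutativeRing (ΛRing b)
    module C = CommutativeRing (ΛRing c)
    module ω  = IsOmega isOmega
    module ω′ = IsOmega isOmega′
    module ωH  = RingMorphisms.IsRingHomomorphism ω.isRingHomomorphism
    module ω′H = RingMorphisms.IsRingHomomorphism ω′.isRingHomomorphism

  -- On a generator, ω gives h_k(x‖c), and `ω-h` for `ω′` returns e_k(x‖b); the other cases are the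
  -- homomorphism laws and linearity.
  involutive-⟦⟧ : ∀ t → ω′ (ω (⟦_⟧ b t)) ≈Λ ⟦_⟧ b t
  involutive-⟦⟧ (scalar x) n = ≋-trans (ω′H.⟦⟧-cong {ω (x · B.1#)} {x · ω B.1#} (ω.linear x B.1#) n)
    (≋-trans (ω′.linear x (ω B.1#) n) (⊗-cong ≋-refl
      (≋-trans (ω′H.⟦⟧-cong {ω B.1#} {C.1#} ωH.1#-homo n) (ω′H.1#-homo n))))
  involutive-⟦⟧ (generator k 1≤k) n = ≋-trans (ω′H.⟦⟧-cong {ω (e b k)} {h c k} (ω.e↦h k 1≤k) n) (ω-h dual isOmega′ k n)
  involutive-⟦⟧ (sum s t) n = ≋-trans
    (ω′H.⟦⟧-cong {ω (⟦_⟧ b s B.+ ⟦_⟧ b t)} {ω (⟦_⟧ b s) C.+ ω (⟦_⟧ b t)} (ωH.+-homo (⟦_⟧ b s) (⟦_⟧ b t)) n)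
    (≋-trans (ω′H.+-homo (ω (⟦_⟧ b s)) (ω (⟦_⟧ b t)) n) (⊕-cong (involutive-⟦⟧ s n) (involutive-⟦⟧ t n)))
  involutive-⟦⟧ (product s t) n = ≋-trans
    (ω′H.⟦⟧-cong {ω (⟦_⟧ b s B.* ⟦_⟧ b t)} {ω (⟦_⟧ b s) C.* ω (⟦_⟧ b t)} (ωH.*-homo (⟦_⟧ b s) (⟦_⟧ b t)) n)
    (≋-trans (ω′H.*-homo (ω (⟦_⟧ b s)) (ω (⟦_⟧ b t)) n) (⊗-cong (involutive-⟦⟧ s n) (involutive-⟦⟧ t n)))

  involutive : ∀ P → ω′ (ω P) ≈Λ P
  involutive P n = ≋-trans
    (ω′H.⟦⟧-cong {ω P} {ω (⟦_⟧ b t)} (ωH.⟦⟧-cong {P} {⟦_⟧ b t} P≈t) n)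
    (≋-trans (involutive-⟦⟧ t n) (≋-sym (P≈t n)))
    where
    t = proj₁ (generation b P)
    P≈t : P ≈Λ ⟦_⟧ b t
    P≈t = proj₂ (generation b P)

-- This is (a′)′ = a, the duality needed to apply `ω-h` to the map from Λ(x‖a′) back to Λ(x‖a).
a-dual : ∀ i → a i ℚ[a].≈ ℚ[a].- a′ (mirror i)
a-dual i = ℚ[a].trans (ℚ[a].reflexive (≡.cong a (≡.sym (mirror-involutive i)))) (ℚ[a].sym (-‿involutive _))
  where open Algebra.Properties.Ring ℚ[a].ring using (-‿involutive)

proposition2p3 : (ω : Λ a → Λ a′) → IsOmega a a′ ω →
    ((ω′ : Λ a′ → Λ a) → IsOmega a′ a ω′ → (P : Λ a) → ω′ (ω P) ≈Λ P)
    × ((μ : Partition) → ω (hProduct a μ) ≈Λ eProduct a′ μ)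
proposition2p3 ω isOmega =
  (λ ω′ isOmega′ → involutive a-dual isOmega isOmega′) ,
  -- In this direction the duality is the definition of `a′`.
  λ μ → ω-hList (λ i → ℚ[a].refl) isOmega (Partition.parts μ)
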